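{- Suppose $G$ and $\boldsymbol d$ satisfy assumptions (a), (c), (d) of the context. Let $Q(G)$ be the signless Laplacian of $G$ and define $\boldsymbol\beta$ by $$\beta_j:=\tfrac12\log\frac{\lambda}{1-\lambda}+\gamma_j,\qquad \boldsymbol\gamma=(\gamma_1,\dots,\gamma_n)^{\mathsf T}:=\Lambda^{ -1}Q(G)^{ -1}(\boldsymbol d-\lambda\boldsymbol g).$$ Suppose $$\|\boldsymbol d-\lambda\boldsymbol g\|_\infty=O(\Lambda^{3/4}n^{3/4-\sigma/4})\quad\text{and}\quad \|\boldsymbol d-\lambda\boldsymbol g\|_2=O(\Lambda^{1/2}n^{1+\varepsilon/2}).$$ Then $\boldsymbol\beta$ satisfies assumptions (b) and (e) of the context, with $$\|\boldsymbol\delta\|_\infty=O(\Lambda^{ -1}n^{ -1})\,\|\boldsymbol d-\lambda\boldsymbol g\|_\infty^2\quad\text{and}\quad \|\boldsymbol\delta\|_1=O(\Lambda^{ -1}n^{ -1})\,\|\boldsymbol d-\lambda\boldsymbol g\|_2^2 .$$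
   Context: All graphs are labelled and simple. $G$ is a graph with vertex set $[n]$ and degree sequence $\boldsymbol g=(g_1,\dots,g_n)$; $jk\in G$ means $\{j,k\}\in E(G)$. $\boldsymbol d=(d_1,\dots,d_n)$ is a positive integer sequence with even sum. For $\boldsymbol\beta\in\mathbb R^n$, $\lambda_{jk}=\lambda_{jk}(\boldsymbol\beta)=\frac{e^{\beta_j+\beta_k}}{1+e^{\beta_j+\beta_k}}$, and $\boldsymbol\delta=(\delta_1,\dots,\delta_n)$ with $\delta_j=\sum_{k:jk\in G}\lambda_{jk}-d_j$. Also $\lambda=\frac{\sum_jd_j}{\sum_jg_j}$ and $\Lambda=\lambda(1-\lambda)$. The signless Laplacian $Q(G)$ has diagonal entries $g_j$, entries $1$ where $jk\in G$, and $0$ otherwise; $q(G)$ is its least eigenvalue. The Cheeger constant is $h(G)=\min_{1\le|U|\le n/2}|\partial_GU|/|U|$, where $\partial_GU$ is the set of edges with exactly one end in $U\subseteq[n]$. Assumptions, with positive constants $\sigma,B,C,\tau_Q$ and sufficiently small $\varepsilon>0$: (a) $d_j\le g_j$ for all $j\in[n]$; (b) $|\beta_j-\beta_k|\le C$ for all $j,k\in[n]$; (c) $\Lambda\ge Bn^{\sigma-1}$; (d) $h(G)\ge\Lambda^{ -1}\log^2n$ and $q(G)\ge\tau_Qn$; (e) $\|\boldsymbol\delta\|_\infty=O(\Lambda^{1/2}n^{1/2-\sigma/2})$ and $\|\boldsymbol\delta\|_1=O(n^{1+\varepsilon})$. (In the conclusion, (b) means that it holds for some constant $C$.) Asymptotics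 are for $n\to\infty$; implied constants in $O(\cdot)$ depend only on the constants of the assumptions and $\varepsilon$ (and on the implied constants in the hypotheses), and bounds hold for all sufficiently large $n$ and sufficiently small $\varepsilon>0$. -}

module Defs where

open import Algebra.Bundles using (CommutativeRing)
open import Algebra.Core using (Op₁; Op₂)
import Algebra.Construct.NaturalChoice.Max as Max
import Algebra.Properties.CommutativeMonoid.Sum as Sum
import Algebra.Properties.Monoid.Mult as Mult
import Algebra.Structures as Structures
open import Data.Bool using (Bool; true; false; if_then_else_; _∧_; _xor_)
open import Data.Fin using (Fin; _≟_; _<?_)
open import Data.Fin.Subset using (Subset; ∣_∣)
open import Data.Nat as ℕ using (ℕ)
open import Data.Nat.Properties using (+-0-commutativeMonoid)
open import Data.Product using (_×_; ∃-syntax)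
open import Data.Vec using (lookup)
open import Data.Vec.Functional using (Vector; foldr)
open import Level using (0ℓ)
open import Relation.Binary.Bundles using (DecTotalOrder; TotalOrder)
open import Relation.Binary.Core using (Rel)
import Relation.Binary.Construct.NonStrictToStrict as ToStrict
open import Relation.Binary.PropositionalEquality using (_≡_)
open import Relation.Binary.Structures using (IsDecTotalOrder)
open import Relation.Nullary using (¬_; ⌊_⌋)

-- A complete ordered field, which is unique up to unique isomorphism, together
-- with its exponential and logarithm.  Decidability of the order, with suprema
-- of arbitrary predicates, makes this the classical real line (it entails
-- excluded middle for Set; conversely, under excluded middle the usual
-- constructions of the reals from ℚ are models).
record RealNumbers : Set₁ where
  infix  4 _≈_ _≤_
  infixl 6 _+_
  infixl 7 _*_
  infix  8 -_
  infix  9 _⁻¹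
  field
    ℝ       : Set
    _≈_ _≤_ : Rel ℝ 0ℓ
    _+_ _*_ : Op₂ ℝ
    -_ _⁻¹  : Op₁ ℝ
    0# 1#   : ℝ

    isCommutativeRing : Structures.IsCommutativeRing _≈_ _+_ _*_ -_ 0# 1#
    isDecTotalOrder   : IsDecTotalOrder _≈_ _≤_

    0≉1         : ¬ (0# ≈ 1#)
    ⁻¹-cong     : ∀ {x y} → x ≈ y → x ⁻¹ ≈ y ⁻¹
    -- The value of 0# ⁻¹ is left unspecified.
    ⁻¹-inverseʳ : ∀ {x} → ¬ (x ≈ 0#) → x * x ⁻¹ ≈ 1#

    +-monoˡ-≤ : ∀ {x y} z → x ≤ y → x + z ≤ y + z
    *-nonNeg  : ∀ {x y} → 0# ≤ x → 0# ≤ y → 0# ≤ x * y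

    supremum : (P : ℝ → Set) →
               (∃[ x ] P x) →
               (∃[ b ] (∀ x → P x → x ≤ b)) →
               ∃[ s ] ((∀ x → P x → x ≤ s) ×
                       (∀ b → (∀ x → P x → x ≤ b) → s ≤ b))

    -- exp is the only function with these properties: the inequality excludes
    -- every other base and forces continuity.
    exp      : ℝ → ℝ
    exp-cong : ∀ {x y} → x ≈ y → exp x ≈ exp y
    exp-+    : ∀ x y → exp (x + y) ≈ exp x * exp y
    1+x≤expx : ∀ x → 1# + x ≤ exp x

  open ToStrict _≈_ _≤_ public using (_<_)

  field
    -- The values of log at non-positive arguments are left unspecified.
    log      : ℝ → ℝ
    log-cong : ∀ {x y} → x ≈ y → log x ≈ log y
    exp-log  : ∀ {x} → 0# < x → exp (log x) ≈ x

  commutativeRing : CommutativeRing 0ℓ 0ℓ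
  commutativeRing = record { isCommutativeRing = isCommutativeRing }

  decTotalOrder : DecTotalOrder 0ℓ 0ℓ 0ℓ
  decTotalOrder = record { isDecTotalOrder = isDecTotalOrder }

  totalOrder : TotalOrder 0ℓ 0ℓ 0ℓ
  totalOrder = DecTotalOrder.totalOrder decTotalOrder

module ℕ-Sum = Sum +-0-commutativeMonoid

record Graph (n : ℕ) : Set where
  field
    adj    : Fin n → Fin n → Bool
    symm   : ∀ j k → adj j k ≡ adj k j
    irrefl : ∀ j → adj j j ≡ false

  degree : Fin n → ℕ
  degree j = ℕ-Sum.sum (λ k → if adj j k then 1 else 0)

  -- The number of edges {j,k}, listed with j < k, having exactly one end in U.
  boundarySize : Subset n → ℕ
  boundarySize U =
    ℕ-Sum.sum λ j → ℕ-Sum.sum λ k →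
      if ⌊ j <? k ⌋ ∧ adj j k ∧ (lookup U j xor lookup U k) then 1 else 0

open Graph using (adj; degree; boundarySize)

module RealAnalysis (ℛ : RealNumbers) where
  open RealNumbers ℛ public
    using (ℝ; _≈_; _≤_; _<_; _+_; _*_; -_; _⁻¹; 0#; 1#; exp; log)
  open RealNumbers ℛ using (commutativeRing; totalOrder; isDecTotalOrder)
  open IsDecTotalOrder isDecTotalOrder using (_≤?_)
  open CommutativeRing commutativeRing using (+-commutativeMonoid; +-monoid)
  open Max totalOrder public using (_⊔_)
  open Sum +-commutativeMonoid public using (sum)

  infixl 6 _-_
  infixl 7 _/_
  infixr 8 _^_

  _-_ _/_ : Op₂ ℝ
  x - y = x + (- y)
  x / y = x * y ⁻¹

  ι : ℕ → ℝ
  ι n = Mult._×_ +-monoid n 1#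

  ½ : ℝ
  ½ = 1# / ι 2

  -- Real powers.  The value 0# for x ≤ 0# makes x ^ ½ the square root at 0#.
  _^_ : Op₂ ℝ
  x ^ y = if ⌊ x ≤? 0# ⌋ then 0# else exp (y * log x)

  abs : ℝ → ℝ
  abs x = x ⊔ (- x)

  ‖_‖₁ ‖_‖₂ ‖_‖∞ : ∀ {n} → Vector ℝ n → ℝ
  ‖ x ‖₁ = sum (λ j → abs (x j))
  ‖ x ‖₂ = sum (λ j → x j * x j) ^ ½
  ‖ x ‖∞ = foldr _⊔_ 0# (λ j → abs (x j))

  IsLeast : (ℝ → Set) → ℝ → Set
  IsLeast P m = P m × (∀ x → P x → m ≤ x)

  Matrix : ℕ → Set
  Matrix n = Fin n → Fin n → ℝ

  infixr 7 _∙_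
  _∙_ : ∀ {n} → Matrix n → Vector ℝ n → Vector ℝ n
  (M ∙ x) j = sum (λ k → M j k * x k)

  identity : ∀ {n} → Matrix n
  identity j k = if ⌊ j ≟ k ⌋ then 1# else 0#

  IsInverse : ∀ {n} → Matrix n → Matrix n → Set
  IsInverse M N =
    (∀ j k → sum (λ i → M j i * N i k) ≈ identity j k) ×
    (∀ j k → sum (λ i → N j i * M i k) ≈ identity j k)

  IsEigenvalue : ∀ {n} → Matrix n → ℝ → Set
  IsEigenvalue {n} M μ =
    ∃[ x ] ((∃[ j ] ¬ (x j ≈ 0#)) × (∀ j → (M ∙ x) j ≈ μ * x j))

  signlessLaplacian : ∀ {n} → Graph n → Matrix n
  signlessLaplacian G j k =
    if ⌊ j ≟ k ⌋ then ι (degree G j) else (if adj G j k then 1# else 0#)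

  IsLeastEigenvalue : ∀ {n} → Matrix n → ℝ → Set
  IsLeastEigenvalue M = IsLeast (IsEigenvalue M)

  IsCheegerConstant : ∀ {n} → Graph n → ℝ → Set
  IsCheegerConstant {n} G = IsLeast λ x →
    ∃[ U ] (1 ℕ.≤ ∣ U ∣ × 2 ℕ.* ∣ U ∣ ℕ.≤ n ×
            x ≈ ι (boundarySize G U) / ι ∣ U ∣)

  module DegreeSequence {n : ℕ} (G : Graph n) (d : Fin n → ℕ) where

    -- The overall density (written λ in mathematics) and Λ = λ(1 - λ).
    density Λ : ℝ
    density = ι (ℕ-Sum.sum d) / ι (ℕ-Sum.sum (degree G))
    Λ       = density * (1# - density)

    -- d - λ g
    deviation : Vector ℝ n
    deviation j = ι (d j) - density * ι (degree G j)

    edgeProbability : Vector ℝ n → Matrix n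
    edgeProbability β j k = exp (β j + β k) / (1# + exp (β j + β k))

    δ : Vector ℝ n → Vector ℝ n
    δ β j =
      sum (λ k → if adj G j k then edgeProbability β j k else 0#) - ι (d j)

    -- Q⁻¹ stands for the inverse of the signless Laplacian.
    γ : Matrix n → Vector ℝ n
    γ Q⁻¹ j = Λ ⁻¹ * (Q⁻¹ ∙ deviation) j

    β : Matrix n → Vector ℝ n
    β Q⁻¹ j = ½ * log (density / (1# - density)) + γ Q⁻¹ j

{-# OPTIONS --safe #-}
module Submission where

open import Defs
open import Algebra.Bundles using (CommutativeRing)
import Algebra.Construct.NaturalChoice.Max as Max
import Algebra.Construct.NaturalChoice.MaxOp as MaxOp
import Algebra.Properties.Monoid.Mult as MonoidMult
import Algebra.Properties.Ring as RingProperties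
import Algebra.Properties.Semiring.Mult.TCOptimised as Mult
import Algebra.Properties.Semiring.Sum as SemiringSum
import Algebra.Solver.Ring as RingSolver
open import Algebra.Solver.Ring.AlmostCommutativeRing
  using (fromCommutativeRing; _-Raw-AlmostCommutative⟶_)
open import Data.Bool using (true; false; if_then_else_)
open import Data.Fin as Fin using (Fin; zero; suc; punchIn; punchOut)
import Data.Fin.Properties as Fin
open import Data.Integer as ℤ using (ℤ; +_; -[1+_])
import Data.Integer.Properties as ℤ
import Data.Maybe as Maybe
open import Data.Nat as ℕ using (ℕ; zero; suc; s≤s)
open import Data.Nat.Divisibility using (_∣_)
import Data.Nat.Properties as ℕ
open import Data.Product using (_×_; _,_; proj₁; proj₂; ∃-syntax)
open import Data.Sum using (_⊎_; inj₁; inj₂; [_,_]′)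
open import Data.Vec.Functional using (Vector; _∷_)
open import Function using (_∘_; id)
open import Relation.Binary.Bundles using (DecTotalOrder)
import Relation.Binary.Construct.NonStrictToStrict as ToStrict
open import Relation.Binary.PropositionalEquality as ≡ using (_≡_; _≢_)
import Relation.Binary.Reasoning.PartialOrder as PartialOrderReasoning
import Relation.Binary.Reasoning.Setoid as SetoidReasoning
open import Relation.Nullary using (¬_; yes; no; ¬?; contradiction; decidable-stable)
open import Relation.Nullary.Decidable using (dec⇒maybe; toSum)

-- Write y = Q⁻¹ (d - λ g), so that γ = Λ⁻¹ y.  A Taylor expansion of the
-- logistic function gives λ_jk = λ + Λ (γ_j + γ_k) + R_jk with
-- |R_jk| = O(Λ (γ_j + γ_k)²) as long as γ stays bounded.  Summing over the
-- neighbours k of j, the linear terms make up Λ (Q γ)_j = d_j - λ g_j, so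
-- δ_j = Σ_k R_jk = O(Λ (n γ_j² + ‖γ‖₂²)).  It remains to bound y.
--
-- The Rayleigh principle turns q(G) ≥ τ n into ⟪x , Q x⟫ ≥ τ n ‖x‖₂², hence
-- ‖y‖₂ ≤ ‖d - λ g‖₂ / (τ n), and in particular g_j ≥ τ n for every j.  The rows
-- g_j y_j = (d - λ g)_j - Σ_{k∼j} y_k of the system, where by Cauchy-Schwarz
-- Σ_k |y_k| ≤ √n ‖y‖₂ ≤ ‖d - λ g‖∞ / τ, then give ‖y‖∞ = O(‖d - λ g‖∞ / n).
-- The lower bound on Λ makes γ = O(n^{-σ/2}), in particular bounded.

-- The axioms supply an ordered field with suprema and the inequality 1 + x ≤ exp x, and this shapes
-- two steps. The Rayleigh principle has to be reached without compactness or diagonalisation: the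
-- extremal value is the supremum of all t with t ‖x‖₂² ≤ ⟪x , A x⟫, and it is recognised as an
-- eigenvalue through the alternative that a square matrix either is singular or solves every
-- system. The Taylor estimate has to be reached without derivatives: once the denominator is
-- cleared, it follows from tangent lines of exp.
--
-- The exponents of the hypotheses fit the conclusion exactly. Dividing Λ^(3/4) n^(3/4-σ/4) by Λ n
-- leaves Λ^(-1/4) n^(-1/4-σ/4), which the lower bound on Λ keeps bounded. Squaring it first and
-- then dividing by Λ n leaves Λ^(1/2) n^(1/2-σ/2), the first bound of (e). In the same way Λ^(1/2)
-- n^(1+ε/2) yields n^(1+ε), the powers of Λ cancelling.
--
-- Boundedness of γ, as opposed to smallness, is enough for the expansion, so all constants are
-- explicit in B, τ and the two implied constants of the hypotheses.

-- The library's ring solver, with coefficients in ℤ so that cancellation is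
-- recognised over a ring whose own equality does not compute.
module IntegerCoefficientSolver {c ℓ} (R : CommutativeRing c ℓ) where
  open CommutativeRing R
  open RingProperties ring
  open Mult semiring using (×-homo-+; ×1-homo-*; 1+×) renaming (_×_ to _×′_)
  open SetoidReasoning setoid

  -- For the optimised multiple, `1 ×′ 1#` computes to `1#`, so the constant `:1` of a solved
  -- equation matches `1#` in the goal.
  ⟦_⟧ℤ : ℤ → Carrier
  ⟦ + n ⟧ℤ      = n ×′ 1#
  ⟦ -[1+ n ] ⟧ℤ = - (suc n ×′ 1#)

  ⊖-homo : ∀ m n → ⟦ m ℤ.⊖ n ⟧ℤ ≈ m ×′ 1# + - (n ×′ 1#)
  ⊖-homo m zero = sym (trans (+-congˡ -0#≈0#) (+-identityʳ _))
  ⊖-homo zero (suc n) = sym (+-identityˡ _)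
  ⊖-homo (suc m) (suc n) = begin
    ⟦ suc m ℤ.⊖ suc n ⟧ℤ                       ≡⟨ ≡.cong ⟦_⟧ℤ (ℤ.[1+m]⊖[1+n]≡m⊖n m n) ⟩
    ⟦ m ℤ.⊖ n ⟧ℤ                               ≈⟨ ⊖-homo m n ⟩
    a + - b                                    ≈⟨ +-congʳ (+-identityˡ a) ⟨
    0# + a + - b                               ≈⟨ +-congʳ (+-congʳ (-‿inverseʳ 1#)) ⟨
    1# + - 1# + a + - b                        ≈⟨ +-congʳ (+-assoc _ _ _) ⟩
    1# + (- 1# + a) + - b                      ≈⟨ +-congʳ (+-congˡ (+-comm _ _)) ⟩
    1# + (a + - 1#) + - b                      ≈⟨ +-congʳ (+-assoc _ _ _) ⟨
    1# + a + - 1# + - b                        ≈⟨ +-assoc _ _ _ ⟩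
    1# + a + (- 1# + - b)                      ≈⟨ +-cong (sym (1+× m 1#)) (-‿+-comm 1# b) ⟩
    suc m ×′ 1# + - (1# + b)                   ≈⟨ +-congˡ (-‿cong (1+× n 1#)) ⟨
    suc m ×′ 1# + - (suc n ×′ 1#)              ∎
    where
    a = m ×′ 1#
    b = n ×′ 1#

  +-homo : ∀ i j → ⟦ i ℤ.+ j ⟧ℤ ≈ ⟦ i ⟧ℤ + ⟦ j ⟧ℤ
  +-homo (+ m)    (+ n)    = ×-homo-+ 1# m n
  +-homo (+ m)    -[1+ n ] = ⊖-homo m (suc n)
  +-homo -[1+ m ] (+ n)    = trans (⊖-homo n (suc m)) (+-comm _ _)
  +-homo -[1+ m ] -[1+ n ] = begin
    - (suc (suc (m ℕ.+ n)) ×′ 1#)              ≡⟨ ≡.cong (λ k → - (k ×′ 1#)) (≡.cong suc (ℕ.+-suc m n)) ⟨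
    - ((suc m ℕ.+ suc n) ×′ 1#)                ≈⟨ -‿cong (×-homo-+ 1# (suc m) (suc n)) ⟩
    - (suc m ×′ 1# + suc n ×′ 1#)              ≈⟨ -‿+-comm _ _ ⟨
    - (suc m ×′ 1#) + - (suc n ×′ 1#)          ∎

  -‿homo : ∀ i → ⟦ ℤ.- i ⟧ℤ ≈ - ⟦ i ⟧ℤ
  -‿homo (+ zero)  = sym -0#≈0#
  -‿homo (+ suc n) = refl
  -‿homo -[1+ n ]  = sym (-‿involutive _)

  *-homo-+ : ∀ m n → ⟦ + m ℤ.* + n ⟧ℤ ≈ m ×′ 1# * n ×′ 1#
  *-homo-+ m n = trans (reflexive (≡.cong ⟦_⟧ℤ (≡.sym (ℤ.pos-* m n)))) (×1-homo-* m n)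

  *-homo : ∀ i j → ⟦ i ℤ.* j ⟧ℤ ≈ ⟦ i ⟧ℤ * ⟦ j ⟧ℤ
  *-homo (+ m) (+ n) = *-homo-+ m n
  *-homo (+ m) -[1+ n ] = begin
    ⟦ + m ℤ.* -[1+ n ] ⟧ℤ          ≡⟨ ≡.cong ⟦_⟧ℤ (ℤ.neg-distribʳ-* (+ m) (+ suc n)) ⟨
    ⟦ ℤ.- (+ m ℤ.* + suc n) ⟧ℤ     ≈⟨ -‿homo (+ m ℤ.* + suc n) ⟩
    - ⟦ + m ℤ.* + suc n ⟧ℤ         ≈⟨ -‿cong (*-homo-+ m (suc n)) ⟩
    - (m ×′ 1# * suc n ×′ 1#)      ≈⟨ -‿distribʳ-* _ _ ⟩
    m ×′ 1# * - (suc n ×′ 1#)      ∎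
  *-homo -[1+ m ] (+ n) = begin
    ⟦ -[1+ m ] ℤ.* + n ⟧ℤ          ≡⟨ ≡.cong ⟦_⟧ℤ (ℤ.neg-distribˡ-* (+ suc m) (+ n)) ⟨
    ⟦ ℤ.- (+ suc m ℤ.* + n) ⟧ℤ     ≈⟨ -‿homo (+ suc m ℤ.* + n) ⟩
    - ⟦ + suc m ℤ.* + n ⟧ℤ         ≈⟨ -‿cong (*-homo-+ (suc m) n) ⟩
    - (suc m ×′ 1# * n ×′ 1#)      ≈⟨ -‿distribˡ-* _ _ ⟩
    - (suc m ×′ 1#) * n ×′ 1#      ∎
  *-homo -[1+ m ] -[1+ n ] = begin
    ⟦ + suc m ℤ.* + suc n ⟧ℤ            ≈⟨ *-homo-+ (suc m) (suc n) ⟩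
    suc m ×′ 1# * suc n ×′ 1#           ≈⟨ -‿involutive _ ⟨
    - - (suc m ×′ 1# * suc n ×′ 1#)     ≈⟨ -‿cong (-‿distribʳ-* _ _) ⟩
    - (suc m ×′ 1# * - (suc n ×′ 1#))   ≈⟨ -‿distribˡ-* _ _ ⟩
    - (suc m ×′ 1#) * - (suc n ×′ 1#)   ∎

  morphism : ℤ.+-*-rawRing -Raw-AlmostCommutative⟶ fromCommutativeRing R
  morphism = record
    { ⟦_⟧    = ⟦_⟧ℤ
    ; +-homo = +-homo
    ; *-homo = *-homo
    ; -‿homo = -‿homo
    ; 0-homo = refl
    ; 1-homo = refl
    }

  open RingSolver ℤ.+-*-rawRing (fromCommutativeRing R) morphism
    (λ i j → Maybe.map (λ i≡j → reflexive (≡.cong ⟦_⟧ℤ i≡j)) (dec⇒maybe (i ℤ.≟ j)))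
    public using (solve; _:=_; _:+_; _:*_; _:-_; :-_; con; Polynomial)

  :0 :1 : ∀ {n} → Polynomial n
  :0 = con (+ 0)
  :1 = con (+ 1)

  -- Denotes the n-fold sum 1# + (1# + ... + 0#) on the nose.
  :ι : ∀ {n} → ℕ → Polynomial n
  :ι zero    = :0
  :ι (suc m) = :1 :+ :ι m

-- Ordered fields: inequalities, reciprocals, maxima and absolute values.

module OrderedField (ℛ : RealNumbers) where
  open RealAnalysis ℛ
  open RealNumbers ℛ public
    using (commutativeRing; decTotalOrder; totalOrder; 0≉1; ⁻¹-inverseʳ; ⁻¹-cong; +-monoˡ-≤; *-nonNeg)
  open CommutativeRing commutativeRing public
    hiding (Carrier; _≈_; _+_; _*_; -_; _-_; 0#; 1#; _≉_; rawRing; isEquivalence; isPartialEquivalence;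
            isCommutativeRing; zero)
    renaming (-‿inverseʳ to +-inverseʳ)
  open DecTotalOrder decTotalOrder public
    using (_≟_; _≤?_; poset)
    renaming (refl to ≤-refl; reflexive to ≤-reflexive; trans to ≤-trans; antisym to ≤-antisym;
              total to ≤-total; ≤-respʳ-≈ to ≤-respʳ; ≤-respˡ-≈ to ≤-respˡ)
  open IntegerCoefficientSolver commutativeRing public
    using (solve; _:=_; _:+_; _:*_; _:-_; :-_; :0; :1; :ι)
  private module R = PartialOrderReasoning poset

  x≤y⇒0≤y-x : ∀ {x y} → x ≤ y → 0# ≤ y - x
  x≤y⇒0≤y-x {x} x≤y = ≤-respˡ (+-inverseʳ x) (+-monoˡ-≤ (- x) x≤y)

  0≤y-x⇒x≤y : ∀ {x y} → 0# ≤ y - x → x ≤ y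
  0≤y-x⇒x≤y {x} {y} 0≤ =
    ≤-respˡ (+-identityˡ x)
      (≤-respʳ (solve 2 (λ x y → y :- x :+ x := y) refl x y) (+-monoˡ-≤ x 0≤))

  -- The usual form of an inequality proof below: a manifestly nonnegative certificate `r`, and a
  -- ring identity that the solver checks.
  ≤-from-difference : ∀ {x y r} → 0# ≤ r → y - x ≈ r → x ≤ y
  ≤-from-difference 0≤r eq = 0≤y-x⇒x≤y (≤-respʳ (sym eq) 0≤r)

  x≈y⇒x-y≈0 : ∀ {x y} → x ≈ y → x - y ≈ 0#
  x≈y⇒x-y≈0 {y = y} x≈y = trans (+-congʳ x≈y) (+-inverseʳ y)

  x-y≈0⇒x≈y : ∀ {x y} → x - y ≈ 0# → x ≈ y
  x-y≈0⇒x≈y {x} {y} eq = trans (solve 2 (λ x y → x := x :- y :+ y) refl x y)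
                               (trans (+-congʳ eq) (+-identityˡ y))

  -- The solver proves identities but cannot use a hypothesis such as `x * x ⁻¹ ≈ 1#`. Here the
  -- hypothesis enters with an explicit cofactor `c`, after which only an identity remains.
  ≈-from-multiple : ∀ {x y u v} c → u ≈ v → x - y ≈ c * (u - v) → x ≈ y
  ≈-from-multiple c u≈v eq =
    x-y≈0⇒x≈y (trans eq (trans (*-congˡ (x≈y⇒x-y≈0 u≈v)) (zeroʳ c)))

  +-mono-≤ : ∀ {x y u v} → x ≤ y → u ≤ v → x + u ≤ y + v
  +-mono-≤ {x} {y} {u} {v} x≤y u≤v =
    ≤-trans (+-monoˡ-≤ u x≤y) (≤-respˡ (+-comm u y) (≤-respʳ (+-comm v y) (+-monoˡ-≤ y u≤v)))

  +-nonNeg : ∀ {x y} → 0# ≤ x → 0# ≤ y → 0# ≤ x + y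
  +-nonNeg 0≤x 0≤y = ≤-respˡ (+-identityˡ 0#) (+-mono-≤ 0≤x 0≤y)

  neg-antimono-≤ : ∀ {x y} → x ≤ y → - y ≤ - x
  neg-antimono-≤ {x} {y} x≤y = ≤-from-difference (x≤y⇒0≤y-x x≤y)
    (solve 2 (λ x y → (:- x) :- (:- y) := y :- x) refl x y)

  *-monoʳ-≤-nonNeg : ∀ {c x y} → 0# ≤ c → x ≤ y → c * x ≤ c * y
  *-monoʳ-≤-nonNeg {c} {x} {y} 0≤c x≤y = ≤-from-difference (*-nonNeg 0≤c (x≤y⇒0≤y-x x≤y))
    (solve 3 (λ c x y → c :* y :- c :* x := c :* (y :- x)) refl c x y)

  *-monoˡ-≤-nonNeg : ∀ {c x y} → 0# ≤ c → x ≤ y → x * c ≤ y * c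
  *-monoˡ-≤-nonNeg 0≤c x≤y = ≤-respˡ (*-comm _ _) (≤-respʳ (*-comm _ _) (*-monoʳ-≤-nonNeg 0≤c x≤y))

  *-mono-≤-nonNeg : ∀ {x y u v} → 0# ≤ x → 0# ≤ v → x ≤ y → u ≤ v → x * u ≤ y * v
  *-mono-≤-nonNeg 0≤x 0≤v x≤y u≤v =
    ≤-trans (*-monoʳ-≤-nonNeg 0≤x u≤v) (*-monoˡ-≤-nonNeg 0≤v x≤y)

  square-nonNeg : ∀ x → 0# ≤ x * x
  square-nonNeg x with ≤-total 0# x
  ... | inj₁ 0≤x = *-nonNeg 0≤x 0≤x
  ... | inj₂ x≤0 = ≤-respʳ (solve 1 (λ x → (:0 :- x) :* (:0 :- x) := x :* x) refl x)
                     (*-nonNeg (x≤y⇒0≤y-x x≤0) (x≤y⇒0≤y-x x≤0))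

  0≤1 : 0# ≤ 1#
  0≤1 = ≤-respʳ (*-identityˡ 1#) (square-nonNeg 1#)

  0<1 : 0# < 1#
  0<1 = 0≤1 , 0≉1

  ι-nonNeg : ∀ n → 0# ≤ ι n
  ι-nonNeg zero    = ≤-refl
  ι-nonNeg (suc n) = +-nonNeg 0≤1 (ι-nonNeg n)

  1≤ι[1+n] : ∀ n → 1# ≤ ι (suc n)
  1≤ι[1+n] n = ≤-respˡ (+-identityʳ 1#) (+-mono-≤ ≤-refl (ι-nonNeg n))

  <-≤-trans : ∀ {x y z} → x < y → y ≤ z → x < z
  <-≤-trans = ToStrict.<-≤-trans _≈_ _≤_ sym ≤-trans ≤-antisym ≤-respʳ

  <⇒≱ : ∀ {x y} → x < y → ¬ (y ≤ x)
  <⇒≱ (x≤y , x≉y) y≤x = x≉y (≤-antisym x≤y y≤x)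

  ≰⇒> : ∀ {x y} → ¬ (x ≤ y) → y < x
  ≰⇒> {x} {y} x≰y with ≤-total x y
  ... | inj₁ x≤y = contradiction x≤y x≰y
  ... | inj₂ y≤x = y≤x , λ y≈x → x≰y (≤-reflexive (sym y≈x))

  0<x⇒x≉0 : ∀ {x} → 0# < x → ¬ (x ≈ 0#)
  0<x⇒x≉0 (_ , 0≉x) = 0≉x ∘ sym

  ⁻¹-inverseˡ : ∀ {x} → ¬ (x ≈ 0#) → x ⁻¹ * x ≈ 1#
  ⁻¹-inverseˡ x≉0 = trans (*-comm _ _) (⁻¹-inverseʳ x≉0)

  *-cancelˡ-0 : ∀ {x y} → ¬ (x ≈ 0#) → x * y ≈ 0# → y ≈ 0#
  *-cancelˡ-0 {x} {y} x≉0 xy≈0 = R.begin-equality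
    y               R.≈⟨ *-identityˡ y ⟨
    1# * y          R.≈⟨ *-congʳ (⁻¹-inverseˡ x≉0) ⟨
    x ⁻¹ * x * y    R.≈⟨ *-assoc _ _ _ ⟩
    x ⁻¹ * (x * y)  R.≈⟨ *-congˡ xy≈0 ⟩
    x ⁻¹ * 0#       R.≈⟨ zeroʳ _ ⟩
    0#              R.∎

  *-pos : ∀ {x y} → 0# < x → 0# < y → 0# < x * y
  *-pos 0<x 0<y = *-nonNeg (proj₁ 0<x) (proj₁ 0<y) ,
    λ 0≈xy → 0<x⇒x≉0 0<y (*-cancelˡ-0 (0<x⇒x≉0 0<x) (sym 0≈xy))

  +-pos-nonNeg : ∀ {x y} → 0# < x → 0# ≤ y → 0# < x + y
  +-pos-nonNeg {x} 0<x 0≤y = <-≤-trans 0<x (≤-respˡ (+-identityʳ x) (+-mono-≤ ≤-refl 0≤y))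

  square≈0⇒≈0 : ∀ {x} → x * x ≈ 0# → x ≈ 0#
  square≈0⇒≈0 {x} xx≈0 with x ≟ 0#
  ... | yes x≈0 = x≈0
  ... | no  x≉0 = *-cancelˡ-0 x≉0 xx≈0

  ⁻¹-pos : ∀ {x} → 0# < x → 0# < x ⁻¹
  ⁻¹-pos {x} 0<x =
    ≤-respʳ (trans (*-assoc _ _ _) (trans (*-congˡ (⁻¹-inverseˡ x≉0)) (*-identityʳ _)))
      (*-nonNeg (square-nonNeg (x ⁻¹)) (proj₁ 0<x)) ,
    λ 0≈x⁻¹ → 0≉1 (trans (sym (zeroʳ x)) (trans (*-congˡ 0≈x⁻¹) (⁻¹-inverseʳ x≉0)))
    where x≉0 = 0<x⇒x≉0 0<x

  *-cancelˡ-≤-pos : ∀ {c x y} → 0# < c → c * x ≤ c * y → x ≤ y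
  *-cancelˡ-≤-pos {c} {x} {y} 0<c cx≤cy = R.begin
    x               R.≈⟨ undo x ⟨
    c ⁻¹ * (c * x)  R.≤⟨ *-monoʳ-≤-nonNeg (proj₁ (⁻¹-pos 0<c)) cx≤cy ⟩
    c ⁻¹ * (c * y)  R.≈⟨ undo y ⟩
    y               R.∎
    where
    undo : ∀ z → c ⁻¹ * (c * z) ≈ z
    undo z = trans (sym (*-assoc _ _ _)) (trans (*-congʳ (⁻¹-inverseˡ (0<x⇒x≉0 0<c))) (*-identityˡ z))

  c*x≤y⇒x≤c⁻¹*y : ∀ {c x y} → 0# < c → c * x ≤ y → x ≤ c ⁻¹ * y
  c*x≤y⇒x≤c⁻¹*y {c} {x} {y} 0<c cx≤y = *-cancelˡ-≤-pos 0<c (≤-respʳ (sym eq) cx≤y)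
    where
    eq : c * (c ⁻¹ * y) ≈ y
    eq = trans (sym (*-assoc _ _ _)) (trans (*-congʳ (⁻¹-inverseʳ (0<x⇒x≉0 0<c))) (*-identityˡ y))

  ⁻¹-unique : ∀ {x y} → x * y ≈ 1# → x ⁻¹ ≈ y
  ⁻¹-unique {x} {y} xy≈1 = R.begin-equality
    x ⁻¹            R.≈⟨ *-identityʳ _ ⟨
    x ⁻¹ * 1#       R.≈⟨ *-congˡ xy≈1 ⟨
    x ⁻¹ * (x * y)  R.≈⟨ *-assoc _ _ _ ⟨
    x ⁻¹ * x * y    R.≈⟨ *-congʳ (⁻¹-inverseˡ x≉0) ⟩
    1# * y          R.≈⟨ *-identityˡ y ⟩
    y               R.∎
    where
    x≉0 : ¬ (x ≈ 0#)
    x≉0 x≈0 = 0≉1 (trans (sym (zeroˡ y)) (trans (*-congʳ (sym x≈0)) xy≈1))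

  -- If y ≤ x, then -(x - y)² = (y² - x²) + 2y (x - y) is a sum of nonnegative terms, so x = y.
  square-cancel-≤ : ∀ {x y} → 0# ≤ y → x * x ≤ y * y → x ≤ y
  square-cancel-≤ {x} {y} 0≤y xx≤yy with ≤-total x y
  ... | inj₁ x≤y = x≤y
  ... | inj₂ y≤x = ≤-reflexive (x-y≈0⇒x≈y (square≈0⇒≈0 (≤-antisym [x-y]²≤0 (square-nonNeg (x - y)))))
    where
    [x-y]²≤0 : (x - y) * (x - y) ≤ 0#
    [x-y]²≤0 = ≤-from-difference
      (+-nonNeg (x≤y⇒0≤y-x xx≤yy) (*-nonNeg 0≤y+y (x≤y⇒0≤y-x y≤x)))
      (solve 2 (λ x y → :0 :- (x :- y) :* (x :- y) := y :* y :- x :* x :+ (y :+ y) :* (x :- y)) refl x y)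
      where 0≤y+y = +-nonNeg 0≤y 0≤y

  0≤x+x⇒0≤x : ∀ {x} → 0# ≤ x + x → 0# ≤ x
  0≤x+x⇒0≤x {x} 0≤x+x with ≤-total 0# x
  ... | inj₁ 0≤x = 0≤x
  ... | inj₂ x≤0 = ≤-trans 0≤x+x (≤-respʳ (+-identityʳ x) (+-mono-≤ ≤-refl x≤0))

  -- A nonpositive `r` makes the left side nonpositive, so its sign need not be known. This is how a
  -- degree is replaced by its lower bound although the entries of the solution have either sign.
  replace-factor : ∀ {c g r b} → 0# ≤ c → c ≤ g → 0# ≤ b → g * r ≤ b → c * r ≤ b
  replace-factor {c} {g} {r} 0≤c c≤g 0≤b gr≤b with ≤-total r 0#
  ... | inj₁ r≤0 = ≤-trans (≤-respʳ (zeroʳ c) (*-monoʳ-≤-nonNeg 0≤c r≤0)) 0≤b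
  ... | inj₂ 0≤r = ≤-trans (*-monoˡ-≤-nonNeg 0≤r c≤g) gr≤b

  absorb-factor : ∀ {c r b} → 1# ≤ c → 0# ≤ b → c * r ≤ b → r ≤ b
  absorb-factor 1≤c 0≤b cr≤b = ≤-respˡ (*-identityˡ _) (replace-factor 0≤1 1≤c 0≤b cr≤b)

  0<ι[1+n] : ∀ n → 0# < ι (suc n)
  0<ι[1+n] n = <-≤-trans 0<1 (1≤ι[1+n] n)

  ι[1+n]*ι[1+n]⁻¹≈1 : ∀ n → ι (suc n) * ι (suc n) ⁻¹ ≈ 1#
  ι[1+n]*ι[1+n]⁻¹≈1 n = ⁻¹-inverseʳ (0<x⇒x≉0 (0<ι[1+n] n))

  private module M = MaxOp (Max.maxOperator totalOrder)

  x≤x⊔y : ∀ x y → x ≤ x ⊔ y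
  x≤x⊔y = M.x≤x⊔y

  y≤x⊔y : ∀ x y → y ≤ x ⊔ y
  y≤x⊔y x y = M.x≤y⊔x x y

  ⊔-lub : ∀ {x y z} → x ≤ z → y ≤ z → x ⊔ y ≤ z
  ⊔-lub = M.⊔-lub

  x≤abs : ∀ x → x ≤ abs x
  x≤abs x = x≤x⊔y x (- x)

  -x≤abs : ∀ x → - x ≤ abs x
  -x≤abs x = y≤x⊔y x (- x)

  abs-lub : ∀ {x b} → x ≤ b → - x ≤ b → abs x ≤ b
  abs-lub = ⊔-lub

  abs-cong : ∀ {x y} → x ≈ y → abs x ≈ abs y
  abs-cong x≈y = M.⊔-cong x≈y (-‿cong x≈y)

  abs-nonNeg : ∀ x → 0# ≤ abs x
  abs-nonNeg x with ≤-total 0# x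
  ... | inj₁ 0≤x = ≤-trans 0≤x (x≤abs x)
  ... | inj₂ x≤0 = ≤-trans (≤-respˡ (solve 0 (:- :0 := :0) refl) (neg-antimono-≤ x≤0)) (-x≤abs x)

  abs-square : ∀ x → abs x * abs x ≈ x * x
  abs-square x with ≤-total 0# x
  ... | inj₁ 0≤x = *-cong eq eq
    where
    eq : abs x ≈ x
    eq = ≤-antisym (abs-lub ≤-refl (≤-trans (≤-respʳ (solve 0 (:- :0 := :0) refl) (neg-antimono-≤ 0≤x)) 0≤x)) (x≤abs x)
  ... | inj₂ x≤0 = trans (*-cong eq eq) (solve 1 (λ x → (:- x) :* (:- x) := x :* x) refl x)
    where
    eq : abs x ≈ - x
    eq = ≤-antisym (abs-lub (≤-trans x≤0 (≤-respˡ (solve 0 (:- :0 := :0) refl) (neg-antimono-≤ x≤0))) ≤-refl) (-x≤abs x)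

  abs-*-≤ : ∀ {x b} c → 0# ≤ c → abs x ≤ b → abs (c * x) ≤ c * b
  abs-*-≤ {x} c 0≤c |x|≤b = abs-lub
    (*-monoʳ-≤-nonNeg 0≤c (≤-trans (x≤abs x) |x|≤b))
    (≤-respˡ (solve 2 (λ c x → c :* (:- x) := :- (c :* x)) refl c x)
      (*-monoʳ-≤-nonNeg 0≤c (≤-trans (-x≤abs x) |x|≤b)))

  abs-+-≤ : ∀ {x y a b} → abs x ≤ a → abs y ≤ b → abs (x + y) ≤ a + b
  abs-+-≤ {x} {y} |x|≤a |y|≤b = abs-lub
    (+-mono-≤ (≤-trans (x≤abs x) |x|≤a) (≤-trans (x≤abs y) |y|≤b))
    (≤-respˡ (solve 2 (λ x y → (:- x) :+ (:- y) := :- (x :+ y)) refl x y)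
      (+-mono-≤ (≤-trans (-x≤abs x) |x|≤a) (≤-trans (-x≤abs y) |y|≤b)))

  abs-neg-≤ : ∀ {x b} → abs x ≤ b → abs (- x) ≤ b
  abs-neg-≤ {x} |x|≤b = abs-lub (≤-trans (-x≤abs x) |x|≤b)
    (≤-respˡ (solve 1 (λ x → x := :- (:- x)) refl x) (≤-trans (x≤abs x) |x|≤b))

  -- Twice the difference is (|a| - a)(b + p) + (|a| + a)(b - p), which spares a case distinction on
  -- the signs of `a` and `p`.
  abs-≤-product : ∀ a {p b} → p ≤ b → - p ≤ b → a * p ≤ abs a * b
  abs-≤-product a {p} {b} p≤b -p≤b = 0≤y-x⇒x≤y (0≤x+x⇒0≤x (≤-respʳ
    (solve 4 (λ c a b p → (c :- a) :* (b :- (:- p)) :+ (c :- (:- a)) :* (b :- p)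
                := (c :* b :- a :* p) :+ (c :* b :- a :* p)) refl (abs a) a b p)
    (+-nonNeg (*-nonNeg (x≤y⇒0≤y-x (x≤abs a)) (x≤y⇒0≤y-x -p≤b))
              (*-nonNeg (x≤y⇒0≤y-x (-x≤abs a)) (x≤y⇒0≤y-x p≤b)))))

module LinearAlgebra (ℛ : RealNumbers) where
  open RealAnalysis ℛ
  open RealNumbers ℛ using (supremum)
  open OrderedField ℛ
  open SemiringSum semiring using (sum-cong-≋; ∑-distrib-+; ∑-comm; *-distribˡ-sum; *-distribʳ-sum; sum-remove; sum-replicate-zero)
  private module R = PartialOrderReasoning poset

  sum-cong : ∀ {n} {x y : Vector ℝ n} → (∀ j → x j ≈ y j) → sum x ≈ sum y
  sum-cong = sum-cong-≋

  sum-zero : ∀ {n} {x : Vector ℝ n} → (∀ j → x j ≈ 0#) → sum x ≈ 0#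
  sum-zero {n} x≈0 = trans (sum-cong x≈0) (sum-replicate-zero n)

  sum-linear : ∀ {n} a b (x y : Vector ℝ n) →
               sum (λ j → a * x j + b * y j) ≈ a * sum x + b * sum y
  sum-linear a b x y = trans (∑-distrib-+ (λ j → a * x j) (λ j → b * y j))
                             (+-cong (sym (*-distribˡ-sum a x)) (sym (*-distribˡ-sum b y)))

  sum-mono-≤ : ∀ {n} {x y : Vector ℝ n} → (∀ j → x j ≤ y j) → sum x ≤ sum y
  sum-mono-≤ {zero}  x≤y = ≤-refl
  sum-mono-≤ {suc n} x≤y = +-mono-≤ (x≤y zero) (sum-mono-≤ (x≤y ∘ suc))

  sum-nonNeg : ∀ {n} {x : Vector ℝ n} → (∀ j → 0# ≤ x j) → 0# ≤ sum x
  sum-nonNeg {n} 0≤x = ≤-respˡ (sum-replicate-zero n) (sum-mono-≤ 0≤x)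

  term≤sum : ∀ {n} {x : Vector ℝ n} → (∀ j → 0# ≤ x j) → ∀ j → x j ≤ sum x
  term≤sum {suc n} {x} 0≤x j = R.begin
    x j                            R.≈⟨ +-identityʳ _ ⟨
    x j + 0#                       R.≤⟨ +-mono-≤ ≤-refl (sum-nonNeg (λ k → 0≤x (punchIn j k))) ⟩
    x j + sum (x ∘ punchIn j)      R.≈⟨ sum-remove {i = j} x ⟨
    sum x                          R.∎

  sum-const : ∀ n c → sum {n} (λ _ → c) ≈ ι n * c
  sum-const zero    c = sym (zeroˡ c)
  sum-const (suc n) c = trans (+-congˡ (sum-const n c))
    (solve 2 (λ c m → c :+ m :* c := (:1 :+ m) :* c) refl c (ι n))

  identity-diagonal : ∀ {n} (j : Fin n) → identity j j ≈ 1#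
  identity-diagonal j with j Fin.≟ j
  ... | yes _  = refl
  ... | no j≢j = contradiction ≡.refl j≢j

  identity-off-diagonal : ∀ {n} {j k : Fin n} → j ≢ k → identity j k ≈ 0#
  identity-off-diagonal {j = j} {k} j≢k with j Fin.≟ k
  ... | yes j≡k = contradiction j≡k j≢k
  ... | no _    = refl

  identity-sym : ∀ {n} (j k : Fin n) → identity j k ≈ identity k j
  identity-sym j k with j Fin.≟ k
  ... | yes ≡.refl = sym (identity-diagonal j)
  ... | no j≢k     = sym (identity-off-diagonal (j≢k ∘ ≡.sym))

  identity-∙ : ∀ {n} (x : Vector ℝ n) j → (identity ∙ x) j ≈ x j
  identity-∙ {suc n} x j = R.begin-equality
    (identity ∙ x) j
      R.≈⟨ sum-remove {i = j} (λ k → identity j k * x k) ⟩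
    identity j j * x j + sum (λ k → identity j (punchIn j k) * x (punchIn j k))
      R.≈⟨ +-cong (*-congʳ (identity-diagonal j))
            (sum-zero (λ k → trans (*-congʳ (identity-off-diagonal (Fin.punchInᵢ≢i j k ∘ ≡.sym))) (zeroˡ _))) ⟩
    1# * x j + 0#
      R.≈⟨ solve 1 (λ x → :1 :* x :+ :0 := x) refl (x j) ⟩
    x j R.∎

  ∙-congˡ : ∀ {n} (A : Matrix n) {x y : Vector ℝ n} → (∀ j → x j ≈ y j) → ∀ j → (A ∙ x) j ≈ (A ∙ y) j
  ∙-congˡ A x≈y j = sum-cong (λ k → *-congˡ (x≈y k))

  ∙-linear : ∀ {n} (A : Matrix n) a b (x y : Vector ℝ n) j →
             (A ∙ (λ k → a * x k + b * y k)) j ≈ a * (A ∙ x) j + b * (A ∙ y) j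
  ∙-linear A a b x y j = trans
    (sum-cong (λ k → solve 5 (λ m a b x y → m :* (a :* x :+ b :* y) := a :* (m :* x) :+ b :* (m :* y))
                       refl (A j k) a b (x k) (y k)))
    (sum-linear a b (λ k → A j k * x k) (λ k → A j k * y k))

  matrix-linear-∙ : ∀ {n} a b (A B : Matrix n) x j →
                    ((λ i k → a * A i k + b * B i k) ∙ x) j ≈ a * (A ∙ x) j + b * (B ∙ x) j
  matrix-linear-∙ a b A B x j = trans
    (sum-cong (λ k → solve 5 (λ a b A B x → (a :* A :+ b :* B) :* x := a :* (A :* x) :+ b :* (B :* x))
                       refl a b (A j k) (B j k) (x k)))
    (sum-linear a b (λ k → A j k * x k) (λ k → B j k * x k))

  ∙-∙ : ∀ {n} (A B : Matrix n) x j →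
        (A ∙ B ∙ x) j ≈ sum (λ k → sum (λ i → A j i * B i k) * x k)
  ∙-∙ A B x j = R.begin-equality
    sum (λ i → A j i * sum (λ k → B i k * x k))
      R.≈⟨ sum-cong (λ i → *-distribˡ-sum (A j i) (λ k → B i k * x k)) ⟩
    sum (λ i → sum (λ k → A j i * (B i k * x k)))
      R.≈⟨ ∑-comm (λ i k → A j i * (B i k * x k)) ⟩
    sum (λ k → sum (λ i → A j i * (B i k * x k)))
      R.≈⟨ sum-cong (λ k → sum-cong (λ i → sym (*-assoc (A j i) (B i k) (x k)))) ⟩
    sum (λ k → sum (λ i → A j i * B i k * x k))
      R.≈⟨ sum-cong (λ k → sym (*-distribʳ-sum (x k) (λ i → A j i * B i k))) ⟩
    sum (λ k → sum (λ i → A j i * B i k) * x k) R.∎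

  rightInverse-∙ : ∀ {n} {A N : Matrix n} → (∀ j k → sum (λ i → A j i * N i k) ≈ identity j k) →
                   ∀ x j → (A ∙ N ∙ x) j ≈ x j
  rightInverse-∙ {A = A} {N} AN≈I x j =
    trans (∙-∙ A N x j) (trans (sum-cong (λ k → *-congʳ (AN≈I j k))) (identity-∙ x j))

  -- Elimination, and inverses of symmetric matrices.

  Solvable Singular : ∀ {n} → Matrix n → Set
  Solvable {n} A = ∀ (b : Vector ℝ n) → ∃[ x ] (∀ j → (A ∙ x) j ≈ b j)
  Singular A = ∃[ x ] ((∃[ j ] ¬ (x j ≈ 0#)) × (∀ j → (A ∙ x) j ≈ 0#))

  -- The Schur complement of the pivot in row `r` of the first column.
  eliminate : ∀ {n} → Matrix (suc n) → Fin (suc n) → Matrix n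
  eliminate A r i j = A (punchIn r i) (suc j) - A (punchIn r i) zero * A r zero ⁻¹ * A r (suc j)

  -- The pivot row determines x₀. Every other row then holds because it differs from its eliminated
  -- form by a multiple of the pivot row.
  back-substitution :
    ∀ {n} (A : Matrix (suc n)) r → ¬ (A r zero ≈ 0#) → ∀ (b : Vector ℝ (suc n)) (z : Vector ℝ n) →
    (∀ i → (eliminate A r ∙ z) i ≈ b (punchIn r i) - A (punchIn r i) zero * A r zero ⁻¹ * b r) →
    ∃[ x₀ ] (∀ j → (A ∙ (x₀ ∷ z)) j ≈ b j)
  back-substitution {n} A r p≉0 b z Bz≈ = x₀ , row
    where
    p = A r zero
    s : Fin (suc n) → ℝ
    s j = sum (λ k → A j (suc k) * z k)
    x₀ = p ⁻¹ * (b r - s r)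

    pivot-row : p * x₀ + s r ≈ b r
    pivot-row = ≈-from-multiple (b r - s r) (⁻¹-inverseʳ p≉0)
      (solve 4 (λ p q b s → p :* (q :* (b :- s)) :+ s :- b := (b :- s) :* (p :* q :- :1)) refl p (p ⁻¹) (b r) (s r))

    eliminated : ∀ i → (eliminate A r ∙ z) i ≈ s (punchIn r i) - A (punchIn r i) zero * p ⁻¹ * s r
    eliminated i = R.begin-equality
      (eliminate A r ∙ z) i
        R.≈⟨ sum-cong (λ k → solve 4 (λ a c e z → (a :- c :* e) :* z := :1 :* (a :* z) :+ (:- c) :* (e :* z))
                 refl (A (punchIn r i) (suc k)) c (A r (suc k)) (z k)) ⟩
      sum (λ k → 1# * (A (punchIn r i) (suc k) * z k) + (- c) * (A r (suc k) * z k))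
        R.≈⟨ sum-linear 1# (- c) (λ k → A (punchIn r i) (suc k) * z k) (λ k → A r (suc k) * z k) ⟩
      1# * s (punchIn r i) + (- c) * s r
        R.≈⟨ solve 3 (λ s c t → :1 :* s :+ (:- c) :* t := s :- c :* t) refl (s (punchIn r i)) c (s r) ⟩
      s (punchIn r i) - c * s r R.∎
      where c = A (punchIn r i) zero * p ⁻¹

    other-row : ∀ i → A (punchIn r i) zero * x₀ + s (punchIn r i) ≈ b (punchIn r i)
    other-row i = ≈-from-multiple 1# (trans (sym (eliminated i)) (Bz≈ i))
      (solve 6 (λ a q b′ s′ b s → a :* (q :* (b′ :- s′)) :+ s :- b
                  := :1 :* ((s :- a :* q :* s′) :- (b :- a :* q :* b′)))
        refl (A (punchIn r i) zero) (p ⁻¹) (b r) (s r) (b (punchIn r i)) (s (punchIn r i)))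

    row : ∀ j → A j zero * x₀ + s j ≈ b j
    row j with r Fin.≟ j
    ... | yes ≡.refl = pivot-row
    ... | no r≢j = ≡.subst (λ j → A j zero * x₀ + s j ≈ b j) (Fin.punchIn-punchOut r≢j)
                     (other-row (punchOut r≢j))

  -- Induction on the size. If the first column vanishes, the first unit vector lies in the kernel.
  -- Otherwise both alternatives lift from the Schur complement by back-substitution, a kernel
  -- vector with right-hand side 0.
  singular-or-solvable : ∀ {n} (A : Matrix n) → Singular A ⊎ Solvable A
  singular-or-solvable {zero}  A = inj₂ λ b → b , λ ()
  singular-or-solvable {suc n} A with Fin.any? (λ r → ¬? (A r zero ≟ 0#))
  ... | no column≈0 = inj₁ (1# ∷ (λ _ → 0#) , (zero , 0≉1 ∘ sym) , λ j → R.begin-equality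
    A j zero * 1# + sum (λ k → A j (suc k) * 0#)
      R.≈⟨ +-cong (*-congʳ (decidable-stable (A j zero ≟ 0#) (λ ≉0 → column≈0 (j , ≉0))))
                  (sum-zero (λ k → zeroʳ (A j (suc k)))) ⟩
    0# * 1# + 0#
      R.≈⟨ solve 0 (:0 :* :1 :+ :0 := :0) refl ⟩
    0# R.∎)
  ... | yes (r , p≉0) with singular-or-solvable (eliminate A r)
  ...   | inj₁ (z , (k , zₖ≉0) , Bz≈0) =
    let x₀ , Ax≈0 = back-substitution A r p≉0 (λ _ → 0#) z
                      (λ i → trans (Bz≈0 i) (solve 1 (λ c → :0 := :0 :- c :* :0) refl _))
    in inj₁ (x₀ ∷ z , (suc k , zₖ≉0) , Ax≈0)
  ...   | inj₂ solvable = inj₂ λ b →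
    let z , Bz≈ = solvable _
        x₀ , Ax≈b = back-substitution A r p≉0 b z Bz≈
    in x₀ ∷ z , Ax≈b

  IsSymmetric : ∀ {n} → Matrix n → Set
  IsSymmetric A = ∀ j k → A j k ≈ A k j

  solvable⇒rightInverse : ∀ {n} {A : Matrix n} → Solvable A →
                          ∃[ N ] (∀ j k → sum (λ i → A j i * N i k) ≈ identity j k)
  solvable⇒rightInverse solvable =
    (λ j k → proj₁ (solvable (λ i → identity i k)) j) , (λ j k → proj₂ (solvable (λ i → identity i k)) j)

  -- Transposing A N = I gives Nᵀ A = I as `A` is symmetric. Then N = (Nᵀ A) N = Nᵀ (A N) = Nᵀ, so
  -- `N` is also a left inverse.
  symmetric-solvable⇒inverse : ∀ {n} {A : Matrix n} → IsSymmetric A → Solvable A → ∃[ N ] IsInverse A N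
  symmetric-solvable⇒inverse {A = A} A-sym solvable = N , AN≈I , NA≈I
    where
    N = proj₁ (solvable⇒rightInverse {A = A} solvable)
    AN≈I = proj₂ (solvable⇒rightInverse {A = A} solvable)

    NᵀA≈I : ∀ j k → sum (λ i → N i j * A i k) ≈ identity j k
    NᵀA≈I j k = R.begin-equality
      sum (λ i → N i j * A i k)  R.≈⟨ sum-cong (λ i → trans (*-comm _ _) (*-congʳ (A-sym i k))) ⟩
      sum (λ i → A k i * N i j)  R.≈⟨ AN≈I k j ⟩
      identity k j               R.≈⟨ identity-sym k j ⟩
      identity j k               R.∎

    N-sym : ∀ j k → N j k ≈ N k j
    N-sym j k = R.begin-equality
      N j k                                    R.≈⟨ identity-∙ (λ i → N i k) j ⟨
      sum (λ i → identity j i * N i k)         R.≈⟨ sum-cong (λ i → *-congʳ (sym (NᵀA≈I j i))) ⟩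
      sum (λ i → sum (λ l → N l j * A l i) * N i k)
        R.≈⟨ ∙-∙ (λ i l → N l i) A (λ i → N i k) j ⟨
      sum (λ l → N l j * (A ∙ (λ i → N i k)) l)
        R.≈⟨ sum-cong (λ l → trans (*-comm _ _) (*-congʳ (trans (AN≈I l k) (identity-sym l k)))) ⟩
      sum (λ l → identity k l * N l j)         R.≈⟨ identity-∙ (λ l → N l j) k ⟩
      N k j                                    R.∎

    NA≈I : ∀ j k → sum (λ i → N j i * A i k) ≈ identity j k
    NA≈I j k = trans (sum-cong (λ i → *-congʳ (N-sym j i))) (NᵀA≈I j k)

  -- Quadratic forms and the Rayleigh principle.

  infix 10 ⟪_,_⟫
  ⟪_,_⟫ : ∀ {n} → Vector ℝ n → Vector ℝ n → ℝ
  ⟪ x , y ⟫ = sum (λ j → x j * y j)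

  ⟪⟫-congʳ : ∀ {n} (x : Vector ℝ n) {y z : Vector ℝ n} → (∀ j → y j ≈ z j) → ⟪ x , y ⟫ ≈ ⟪ x , z ⟫
  ⟪⟫-congʳ x y≈z = sum-cong (λ j → *-congˡ (y≈z j))

  ⟪⟫-linearʳ : ∀ {n} a b (x y z : Vector ℝ n) →
               ⟪ x , (λ j → a * y j + b * z j) ⟫ ≈ a * ⟪ x , y ⟫ + b * ⟪ x , z ⟫
  ⟪⟫-linearʳ a b x y z = trans
    (sum-cong (λ j → solve 5 (λ m a b x y → m :* (a :* x :+ b :* y) := a :* (m :* x) :+ b :* (m :* y))
                       refl (x j) a b (y j) (z j)))
    (sum-linear a b (λ j → x j * y j) (λ j → x j * z j))

  ⟪⟫-comm : ∀ {n} (x y : Vector ℝ n) → ⟪ x , y ⟫ ≈ ⟪ y , x ⟫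
  ⟪⟫-comm x y = sum-cong (λ j → *-comm (x j) (y j))

  ⟪x,x⟫-nonNeg : ∀ {n} (x : Vector ℝ n) → 0# ≤ ⟪ x , x ⟫
  ⟪x,x⟫-nonNeg x = sum-nonNeg (λ j → square-nonNeg (x j))

  self-adjoint : ∀ {n} {A : Matrix n} → IsSymmetric A → ∀ x y → ⟪ x , A ∙ y ⟫ ≈ ⟪ A ∙ x , y ⟫
  self-adjoint {A = A} A-sym x y = R.begin-equality
    sum (λ j → x j * sum (λ k → A j k * y k))
      R.≈⟨ sum-cong (λ j → *-distribˡ-sum (x j) (λ k → A j k * y k)) ⟩
    sum (λ j → sum (λ k → x j * (A j k * y k)))
      R.≈⟨ ∑-comm (λ j k → x j * (A j k * y k)) ⟩
    sum (λ k → sum (λ j → x j * (A j k * y k)))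
      R.≈⟨ sum-cong (λ k → sum-cong (λ j → trans (*-congˡ (*-congʳ (A-sym j k)))
             (solve 3 (λ x a y → x :* (a :* y) := a :* x :* y) refl (x j) (A k j) (y k)))) ⟩
    sum (λ k → sum (λ j → A k j * x j * y k))
      R.≈⟨ sum-cong (λ k → sym (*-distribʳ-sum (y k) (λ j → A k j * x j))) ⟩
    sum (λ k → (A ∙ x) k * y k) R.∎

  products≤⟪x,x⟫ : ∀ {n} (x : Vector ℝ n) j k →
                   x j * x k ≤ ⟪ x , x ⟫ × - (x j * x k) ≤ ⟪ x , x ⟫
  products≤⟪x,x⟫ x j k =
    0≤y-x⇒x≤y (0≤x+x⇒0≤x (≤-respʳ
      (solve 3 (λ X y z → (X :- y :* y) :+ (X :- z :* z) :+ (y :- z) :* (y :- z)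
                  := (X :- y :* z) :+ (X :- y :* z)) refl X (x j) (x k))
      (+-nonNeg (+-nonNeg (slack j) (slack k)) (square-nonNeg (x j - x k))))) ,
    0≤y-x⇒x≤y (0≤x+x⇒0≤x (≤-respʳ
      (solve 3 (λ X y z → (X :- y :* y) :+ (X :- z :* z) :+ (y :+ z) :* (y :+ z)
                  := (X :- :- (y :* z)) :+ (X :- :- (y :* z))) refl X (x j) (x k))
      (+-nonNeg (+-nonNeg (slack j) (slack k)) (square-nonNeg (x j + x k)))))
    where
    X = ⟪ x , x ⟫
    slack : ∀ i → 0# ≤ X - x i * x i
    slack i = x≤y⇒0≤y-x (term≤sum (λ i → square-nonNeg (x i)) i)

  -- A crude substitute for the operator norm: the arguments that use it only need some finite bound
  -- on the form.
  entrySum : ∀ {n} → Matrix n → ℝ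
  entrySum A = sum (λ j → sum (λ k → abs (A j k)))

  entrySum-nonNeg : ∀ {n} (A : Matrix n) → 0# ≤ entrySum A
  entrySum-nonNeg A = sum-nonNeg (λ j → sum-nonNeg (λ k → abs-nonNeg (A j k)))

  quadraticForm-≤ : ∀ {n} (A : Matrix n) x → ⟪ x , A ∙ x ⟫ ≤ entrySum A * ⟪ x , x ⟫
  quadraticForm-≤ A x = R.begin
    sum (λ j → x j * sum (λ k → A j k * x k))
      R.≈⟨ sum-cong (λ j → *-distribˡ-sum (x j) (λ k → A j k * x k)) ⟩
    sum (λ j → sum (λ k → x j * (A j k * x k)))
      R.≈⟨ sum-cong (λ j → sum-cong (λ k →
             solve 3 (λ y a z → y :* (a :* z) := a :* (y :* z)) refl (x j) (A j k) (x k))) ⟩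
    sum (λ j → sum (λ k → A j k * (x j * x k)))
      R.≤⟨ sum-mono-≤ (λ j → sum-mono-≤ (λ k → let p , q = products≤⟪x,x⟫ x j k in abs-≤-product (A j k) p q)) ⟩
    sum (λ j → sum (λ k → abs (A j k) * X))
      R.≈⟨ sum-cong (λ j → sym (*-distribʳ-sum X (λ k → abs (A j k)))) ⟩
    sum (λ j → sum (λ k → abs (A j k)) * X)
      R.≈⟨ *-distribʳ-sum X (λ j → sum (λ k → abs (A j k))) ⟨
    entrySum A * X R.∎
    where X = ⟪ x , x ⟫

  -- Nonnegativity of the form at x - r N x, where r⁻¹ bounds the form of N.
  nonNeg-solvable⇒coercive :
    ∀ {n} {A : Matrix n} → IsSymmetric A → (∀ x → 0# ≤ ⟪ x , A ∙ x ⟫) → Solvable A →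
    ∃[ r ] (0# < r × (∀ x → r * ⟪ x , x ⟫ ≤ ⟪ x , A ∙ x ⟫))
  nonNeg-solvable⇒coercive {A = A} A-sym 0≤A solvable = r , 0<r , bound
    where
    N = proj₁ (solvable⇒rightInverse {A = A} solvable)
    AN≈I = proj₂ (solvable⇒rightInverse {A = A} solvable)
    -- The summand 1 makes `c` positive, hence invertible, in size zero too.
    c = 1# + entrySum N
    0<c = +-pos-nonNeg 0<1 (entrySum-nonNeg N)
    r = c ⁻¹
    0<r = ⁻¹-pos 0<c

    bound : ∀ x → r * ⟪ x , x ⟫ ≤ ⟪ x , A ∙ x ⟫
    bound x = 0≤y-x⇒x≤y (R.begin
      0#
        -- With W = `⟪ x , w ⟫` the form at `v` is F - 2rX + r²W, and r²W ≤ r²cX = rX because r =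
        -- c⁻¹.
        R.≤⟨ +-nonNeg (0≤A v) (*-nonNeg (square-nonNeg r) (x≤y⇒0≤y-x ⟪x,w⟫≤cX)) ⟩
      ⟪ v , A ∙ v ⟫ + r * r * (c * X - ⟪ x , w ⟫)
        R.≈⟨ +-congʳ expand ⟩
      F - (r + r) * X + r * r * ⟪ x , w ⟫ + r * r * (c * X - ⟪ x , w ⟫)
        R.≈⟨ ≈-from-multiple (r * X) (⁻¹-inverseʳ (0<x⇒x≉0 0<c))
               (solve 5 (λ F r X W c →
                 F :- (r :+ r) :* X :+ r :* r :* W :+ r :* r :* (c :* X :- W) :- (F :- r :* X)
                 := r :* X :* (c :* r :- :1)) refl F r X ⟪ x , w ⟫ c) ⟩
      F - r * X R.∎)
      where
      X = ⟪ x , x ⟫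
      F = ⟪ x , A ∙ x ⟫
      w = N ∙ x
      v = λ j → 1# * x j + (- r) * w j

      ⟪x,w⟫≤cX : ⟪ x , w ⟫ ≤ c * X
      ⟪x,w⟫≤cX = ≤-trans (quadraticForm-≤ N x)
        (*-monoˡ-≤-nonNeg (⟪x,x⟫-nonNeg x) (≤-respˡ (+-identityˡ _) (+-mono-≤ 0≤1 ≤-refl)))

      Av≈ : ∀ j → (A ∙ v) j ≈ 1# * (A ∙ x) j + (- r) * x j
      Av≈ j = trans (∙-linear A 1# (- r) x w j) (+-congˡ (*-congˡ (rightInverse-∙ {A = A} {N} AN≈I x j)))

      expand : ⟪ v , A ∙ v ⟫ ≈ F - (r + r) * X + r * r * ⟪ x , w ⟫
      expand = R.begin-equality
        ⟪ v , A ∙ v ⟫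
          R.≈⟨ ⟪⟫-congʳ v Av≈ ⟩
        ⟪ v , (λ j → 1# * (A ∙ x) j + (- r) * x j) ⟫
          R.≈⟨ ⟪⟫-linearʳ 1# (- r) v (A ∙ x) x ⟩
        1# * ⟪ v , A ∙ x ⟫ + (- r) * ⟪ v , x ⟫
          R.≈⟨ +-cong (*-congˡ (trans (self-adjoint {A = A} A-sym v x)
                                (trans (⟪⟫-comm (A ∙ v) x) (trans (⟪⟫-congʳ x Av≈) (⟪⟫-linearʳ 1# (- r) x (A ∙ x) x)))))
                      (*-congˡ (trans (⟪⟫-comm v x) (⟪⟫-linearʳ 1# (- r) x x w))) ⟩
        1# * (1# * F + (- r) * X) + (- r) * (1# * X + (- r) * ⟪ x , w ⟫)
          R.≈⟨ solve 4 (λ F X W r → :1 :* (:1 :* F :+ (:- r) :* X) :+ (:- r) :* (:1 :* X :+ (:- r) :* W)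
                          := F :- (r :+ r) :* X :+ r :* r :* W) refl F X ⟪ x , w ⟫ r ⟩
        F - (r + r) * X + r * r * ⟪ x , w ⟫ R.∎

  -- The upper bound for the form of -A, turned around. It provides an admissible `t` with which the
  -- supremum in `rayleigh` can start.
  quadraticForm-≥ : ∀ {n} (A : Matrix n) → ∃[ t ] (∀ x → t * ⟪ x , x ⟫ ≤ ⟪ x , A ∙ x ⟫)
  quadraticForm-≥ A = - e , λ x → R.begin
    - e * ⟪ x , x ⟫
      R.≈⟨ solve 2 (λ e X → (:- e) :* X := :- (e :* X)) refl e ⟪ x , x ⟫ ⟩
    - (e * ⟪ x , x ⟫)
      R.≤⟨ neg-antimono-≤ (quadraticForm-≤ B x) ⟩
    - ⟪ x , B ∙ x ⟫
      R.≈⟨ -‿cong (trans (⟪⟫-congʳ x (matrix-linear-∙ (- 1#) 0# A A x)) (⟪⟫-linearʳ (- 1#) 0# x (A ∙ x) (A ∙ x))) ⟩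
    - ((- 1#) * ⟪ x , A ∙ x ⟫ + 0# * ⟪ x , A ∙ x ⟫)
      R.≈⟨ solve 1 (λ F → :- ((:- :1) :* F :+ :0 :* F) := F) refl ⟪ x , A ∙ x ⟫ ⟩
    ⟪ x , A ∙ x ⟫ R.∎
    where
    B = λ j k → (- 1#) * A j k + 0# * A j k
    e = entrySum B

  -- Covers the vector for which no Rayleigh quotient can be formed: both sides are compared through
  -- 0.
  null-form-≥ : ∀ {n} (A : Matrix n) {x} → ⟪ x , x ⟫ ≤ 0# → ∀ t → t * ⟪ x , x ⟫ ≤ ⟪ x , A ∙ x ⟫
  null-form-≥ A {x} X≤0 t = R.begin
    t * ⟪ x , x ⟫  R.≈⟨ trans (*-congˡ X≈0) (zeroʳ t) ⟩
    0#             R.≈⟨ trans (*-congˡ X≈0) (zeroʳ c) ⟨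
    c * ⟪ x , x ⟫  R.≤⟨ proj₂ (quadraticForm-≥ A) x ⟩
    ⟪ x , A ∙ x ⟫  R.∎
    where
    X≈0 = ≤-antisym X≤0 (⟪x,x⟫-nonNeg x)
    c = proj₁ (quadraticForm-≥ A)

  -- The infimum s of the Rayleigh quotient is an eigenvalue: otherwise A - s I
  -- would be coercive, and s could be increased.  No minimiser is needed.
  infimum-is-eigenvalue :
    ∀ {n} {A : Matrix n} → IsSymmetric A → ∀ s →
    (∀ t → (∀ x → t * ⟪ x , x ⟫ ≤ ⟪ x , A ∙ x ⟫) → t ≤ s) →
    (∀ b → (∀ t → (∀ x → t * ⟪ x , x ⟫ ≤ ⟪ x , A ∙ x ⟫) → t ≤ b) → s ≤ b) →
    IsEigenvalue A s × (∀ x → s * ⟪ x , x ⟫ ≤ ⟪ x , A ∙ x ⟫)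
  infimum-is-eigenvalue {n} {A} A-sym s s-upper s-least =
    [ (λ (v , v≉0 , Bv≈0) → v , v≉0 , eigen v Bv≈0) , (λ solvable → contradiction solvable not-solvable) ]′
      (singular-or-solvable B) , s≤
    where
    s≤ : ∀ y → s * ⟪ y , y ⟫ ≤ ⟪ y , A ∙ y ⟫
    s≤ y with ⟪ y , y ⟫ ≤? 0#
    ... | yes Y≤0 = null-form-≥ A Y≤0 s
    ... | no Y≰0 = R.begin
      s * ⟪ y , y ⟫
        R.≤⟨ *-monoˡ-≤-nonNeg (⟪x,x⟫-nonNeg y)
               -- The Rayleigh quotient of `y` is an upper bound for all admissible `t`, hence at
               -- least `s`. So the supremum is itself admissible.
               (s-least (⟪ y , y ⟫ ⁻¹ * ⟪ y , A ∙ y ⟫) (λ t t≤ → c*x≤y⇒x≤c⁻¹*y (≰⇒> Y≰0) (≤-respˡ (*-comm t ⟪ y , y ⟫) (t≤ y)))) ⟩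
      ⟪ y , y ⟫ ⁻¹ * ⟪ y , A ∙ y ⟫ * ⟪ y , y ⟫
        R.≈⟨ ≈-from-multiple ⟪ y , A ∙ y ⟫ (⁻¹-inverseʳ (0<x⇒x≉0 (≰⇒> Y≰0)))
               (solve 3 (λ i F Y → i :* F :* Y :- F := F :* (Y :* i :- :1)) refl (⟪ y , y ⟫ ⁻¹) ⟪ y , A ∙ y ⟫ ⟪ y , y ⟫) ⟩
      ⟪ y , A ∙ y ⟫ R.∎

    B : Matrix n
    B j k = 1# * A j k + (- s) * identity j k

    B∙ : ∀ y j → (B ∙ y) j ≈ 1# * (A ∙ y) j + (- s) * y j
    B∙ y j = trans (matrix-linear-∙ 1# (- s) A identity y j) (+-congˡ (*-congˡ (identity-∙ y j)))

    B-form : ∀ y → ⟪ y , B ∙ y ⟫ ≈ ⟪ y , A ∙ y ⟫ - s * ⟪ y , y ⟫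
    B-form y = trans (⟪⟫-congʳ y (B∙ y)) (trans (⟪⟫-linearʳ 1# (- s) y (A ∙ y) y)
      (solve 3 (λ F s Y → :1 :* F :+ (:- s) :* Y := F :- s :* Y) refl ⟪ y , A ∙ y ⟫ s ⟪ y , y ⟫))

    B-sym : IsSymmetric B
    B-sym j k = +-cong (*-congˡ (A-sym j k)) (*-congˡ (identity-sym j k))

    0≤B : ∀ y → 0# ≤ ⟪ y , B ∙ y ⟫
    0≤B y = ≤-respʳ (sym (B-form y)) (x≤y⇒0≤y-x (s≤ y))

    eigen : ∀ v → (∀ j → (B ∙ v) j ≈ 0#) → ∀ j → (A ∙ v) j ≈ s * v j
    eigen v Bv≈0 j = ≈-from-multiple 1# (trans (sym (B∙ v j)) (Bv≈0 j))
      (solve 3 (λ a s v → a :- s :* v := :1 :* (:1 :* a :+ (:- s) :* v :- :0)) refl ((A ∙ v) j) s (v j))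

    increased : ∀ r → (∀ y → r * ⟪ y , y ⟫ ≤ ⟪ y , B ∙ y ⟫) → ∀ y → (s + r) * ⟪ y , y ⟫ ≤ ⟪ y , A ∙ y ⟫
    increased r r≤ y = ≤-from-difference (x≤y⇒0≤y-x (≤-respʳ (B-form y) (r≤ y)))
      (solve 4 (λ F s r Y → F :- (s :+ r) :* Y := F :- s :* Y :- r :* Y) refl ⟪ y , A ∙ y ⟫ s r ⟪ y , y ⟫)

    not-solvable : ¬ Solvable B
    not-solvable solvable =
      let r , 0<r , r≤ = nonNeg-solvable⇒coercive {A = B} B-sym 0≤B solvable
          s+r-s≈r = solve 2 (λ s r → s :+ r :- s := r) refl s r
      in <⇒≱ (≤-from-difference (proj₁ 0<r) s+r-s≈r ,
              λ s≈s+r → proj₂ 0<r (trans (sym (x≈y⇒x-y≈0 (sym s≈s+r))) s+r-s≈r))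
             (s-upper (s + r) (increased r r≤))

  -- For nonzero `x` its own Rayleigh quotient bounds the admissible `t` from above, so their
  -- supremum `s` exists. Being an eigenvalue, `s` is at least `μ`.
  rayleigh : ∀ {n} {A : Matrix n} → IsSymmetric A → ∀ μ → (∀ ν → IsEigenvalue A ν → μ ≤ ν) →
             ∀ x → μ * ⟪ x , x ⟫ ≤ ⟪ x , A ∙ x ⟫
  rayleigh {n} {A} A-sym μ μ-least x =
    [ (λ X≤0 → null-form-≥ A X≤0 μ)
    , (λ X≰0 →
        let s , s-upper , s-least = supremum (λ t → ∀ y → t * ⟪ y , y ⟫ ≤ ⟪ y , A ∙ y ⟫)
              (quadraticForm-≥ A)
              (⟪ x , x ⟫ ⁻¹ * ⟪ x , A ∙ x ⟫ ,
               λ t t≤ → c*x≤y⇒x≤c⁻¹*y (≰⇒> X≰0) (≤-respˡ (*-comm t ⟪ x , x ⟫) (t≤ x)))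
            eigenvalue , s≤ = infimum-is-eigenvalue {A = A} A-sym s s-upper s-least
        in ≤-trans (*-monoˡ-≤-nonNeg (⟪x,x⟫-nonNeg x) (μ-least s eigenvalue)) (s≤ x))
    ]′ (toSum (⟪ x , x ⟫ ≤? 0#))

-- The exponential, real powers and the logistic function.

module Exponential (ℛ : RealNumbers) where
  open RealAnalysis ℛ
  open RealNumbers ℛ public using (exp-cong; exp-+; 1+x≤expx; exp-log)
  open OrderedField ℛ
  private module R = PartialOrderReasoning poset

  ½+½≈1 : ½ + ½ ≈ 1#
  ½+½≈1 = trans (solve 1 (λ h → :1 :* h :+ :1 :* h := :ι 2 :* h) refl (ι 2 ⁻¹)) (ι[1+n]*ι[1+n]⁻¹≈1 1)

  ½x+½x≈x : ∀ x → ½ * x + ½ * x ≈ x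
  ½x+½x≈x x = trans (sym (distribʳ x ½ ½)) (trans (*-congʳ ½+½≈1) (*-identityˡ x))

  exp≉0 : ∀ x → ¬ (exp x ≈ 0#)
  exp≉0 x ex≈0 = <⇒≱ 0<1 (R.begin
    1#                                      R.≈⟨ solve 1 (λ x → :1 := :1 :+ (x :- x)) refl x ⟩
    1# + (x - x)                            R.≤⟨ 1+x≤expx (x - x) ⟩
    exp (x - x)                             R.≈⟨ exp-+ x (- x) ⟩
    exp x * exp (- x)                       R.≈⟨ trans (*-congʳ ex≈0) (zeroˡ _) ⟩
    0#                                      R.∎)

  exp-pos : ∀ x → 0# < exp x
  exp-pos x =
    ≤-respʳ (trans (sym (exp-+ (½ * x) (½ * x))) (exp-cong (½x+½x≈x x))) (square-nonNeg (exp (½ * x))) ,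
    λ 0≈ → exp≉0 x (sym 0≈)

  exp0≈1 : exp 0# ≈ 1#
  exp0≈1 = x-y≈0⇒x≈y (*-cancelˡ-0 (exp≉0 0#)
    (trans (solve 1 (λ e → e :* (e :- :1) := e :* e :- e) refl (exp 0#))
           (x≈y⇒x-y≈0 (trans (sym (exp-+ 0# 0#)) (exp-cong (+-identityˡ 0#))))))

  exp-inverse : ∀ x → exp x * exp (- x) ≈ 1#
  exp-inverse x = trans (sym (exp-+ x (- x))) (trans (exp-cong (+-inverseʳ x)) exp0≈1)

  -- The graph of exp lies above each of its tangents. This takes the place of differentiation, and
  -- monotonicity as well as the Taylor estimate rest on it.
  exp-tangent : ∀ x y → exp x * (1# + (y - x)) ≤ exp y
  exp-tangent x y = ≤-respʳ
    (trans (sym (exp-+ x (y - x))) (exp-cong (solve 2 (λ x y → x :+ (y :- x) := y) refl x y)))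
    (*-monoʳ-≤-nonNeg (proj₁ (exp-pos x)) (1+x≤expx (y - x)))

  exp-mono-≤ : ∀ {x y} → x ≤ y → exp x ≤ exp y
  exp-mono-≤ {x} {y} x≤y = ≤-trans
    (≤-from-difference (*-nonNeg (proj₁ (exp-pos x)) (x≤y⇒0≤y-x x≤y))
      (solve 2 (λ e d → e :* (:1 :+ d) :- e := e :* d) refl (exp x) (y - x)))
    (exp-tangent x y)

  exp-cancel-≤ : ∀ {x y} → exp x ≤ exp y → x ≤ y
  exp-cancel-≤ {x} {y} ex≤ey = 0≤y-x⇒x≤y (≤-respʳ (solve 2 (λ x y → :- (x :- y) := y :- x) refl x y)
    (≤-respˡ (solve 0 (:- :0 := :0) refl) (neg-antimono-≤ (*-cancelˡ-≤-pos (exp-pos y) (R.begin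
      exp y * (x - y)                   R.≈⟨ solve 2 (λ e d → e :* d := e :* (:1 :+ d) :- e) refl (exp y) (x - y) ⟩
      exp y * (1# + (x - y)) - exp y    R.≤⟨ +-monoˡ-≤ (- exp y) (≤-trans (exp-tangent y x) ex≤ey) ⟩
      exp y - exp y                     R.≈⟨ trans (+-inverseʳ _) (sym (zeroʳ _)) ⟩
      exp y * 0#                        R.∎)))))

  ^≈exp : ∀ {x} y → 0# < x → x ^ y ≈ exp (y * log x)
  ^≈exp {x} y 0<x with x ≤? 0#
  ... | yes x≤0 = contradiction x≤0 (<⇒≱ 0<x)
  ... | no  _   = refl

  ^-pos : ∀ {x} y → 0# < x → 0# < x ^ y
  ^-pos {x} y 0<x = ≤-respʳ (sym eq) (proj₁ (exp-pos _)) , λ 0≈x^y → exp≉0 _ (sym (trans 0≈x^y eq))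
    where
    eq : x ^ y ≈ exp (y * log x)
    eq = ^≈exp y 0<x

  sqrt-square : ∀ {x} → 0# ≤ x → x ^ ½ * x ^ ½ ≈ x
  sqrt-square {x} 0≤x with x ≤? 0#
  ... | yes x≤0 = trans (zeroˡ 0#) (≤-antisym 0≤x x≤0)
  ... | no x≰0  = R.begin-equality
    exp (½ * log x) * exp (½ * log x)  R.≈⟨ exp-+ (½ * log x) (½ * log x) ⟨
    exp (½ * log x + ½ * log x)        R.≈⟨ exp-cong (½x+½x≈x (log x)) ⟩
    exp (log x)                        R.≈⟨ exp-log (≰⇒> x≰0) ⟩
    x                                  R.∎

  ⁻¹≈exp : ∀ {x} → 0# < x → x ⁻¹ ≈ exp (- log x)
  ⁻¹≈exp {x} 0<x = ⁻¹-unique (trans (*-congʳ (sym (exp-log 0<x))) (exp-inverse (log x)))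

  module Monomials {x y : ℝ} (0<x : 0# < x) (0<y : 0# < y) where

    -- The product of the powers x^a and y^b as one exponential, so that combining powers becomes
    -- ring arithmetic in the exponents.
    monomial : ℝ → ℝ → ℝ
    monomial a b = exp (a * log x + b * log y)

    monomial-cong : ∀ {a a′ b b′} → a ≈ a′ → b ≈ b′ → monomial a b ≈ monomial a′ b′
    monomial-cong a≈ b≈ = exp-cong (+-cong (*-congʳ a≈) (*-congʳ b≈))

    monomial-* : ∀ a b c d → monomial a b * monomial c d ≈ monomial (a + c) (b + d)
    monomial-* a b c d = trans (sym (exp-+ _ _)) (exp-cong
      (solve 6 (λ a b c d x y → (a :* x :+ b :* y) :+ (c :* x :+ d :* y) := (a :+ c) :* x :+ (b :+ d) :* y)
        refl a b c d (log x) (log y)))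

    ^*^≈monomial : ∀ a b → x ^ a * y ^ b ≈ monomial a b
    ^*^≈monomial a b = trans (*-cong (^≈exp a 0<x) (^≈exp b 0<y)) (sym (exp-+ _ _))

    ⁻¹*⁻¹≈monomial : x ⁻¹ * y ⁻¹ ≈ monomial (- 1#) (- 1#)
    ⁻¹*⁻¹≈monomial = trans (*-cong (⁻¹≈exp 0<x) (⁻¹≈exp 0<y)) (trans (sym (exp-+ _ _))
      (exp-cong (solve 2 (λ x y → (:- x) :+ (:- y) := (:- :1) :* x :+ (:- :1) :* y) refl (log x) (log y))))

    reciprocal-scaled-square : ∀ k a b →
      x ⁻¹ * y ⁻¹ * (k * (x ^ a * y ^ b) * (k * (x ^ a * y ^ b))) ≈ k * k * monomial (a + a - 1#) (b + b - 1#)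
    reciprocal-scaled-square k a b = R.begin-equality
      x ⁻¹ * y ⁻¹ * (k * (x ^ a * y ^ b) * (k * (x ^ a * y ^ b)))
        R.≈⟨ *-cong ⁻¹*⁻¹≈monomial (*-cong (*-congˡ (^*^≈monomial a b)) (*-congˡ (^*^≈monomial a b))) ⟩
      monomial (- 1#) (- 1#) * (k * monomial a b * (k * monomial a b))
        R.≈⟨ solve 3 (λ i k m → i :* (k :* m :* (k :* m)) := k :* k :* (m :* m :* i)) refl _ k (monomial a b) ⟩
      k * k * (monomial a b * monomial a b * monomial (- 1#) (- 1#))
        R.≈⟨ *-congˡ (trans (*-congʳ (monomial-* a b a b)) (monomial-* (a + a) (b + b) (- 1#) (- 1#))) ⟩
      k * k * monomial (a + a - 1#) (b + b - 1#) R.∎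

  module Scales {x y : ℝ} (0<x : 0# < x) (1≤y : 1# ≤ y) where
    0<y = <-≤-trans 0<1 1≤y
    open Monomials 0<x 0<y

    private
      f = ι 4 ⁻¹
      4f≈1 = ι[1+n]*ι[1+n]⁻¹≈1 3
      h = ι 2 ⁻¹
      2h≈1 = ι[1+n]*ι[1+n]⁻¹≈1 1
      ℓ = log x
      ν = log y

    0≤log : 0# ≤ log y
    0≤log = exp-cancel-≤ (≤-respˡ (sym exp0≈1) (≤-respʳ (sym (exp-log 0<y)) 1≤y))

    -- After taking logarithms the slack is a quarter of the slack in the lower bound on `x`, plus σ
    -- (log y) / 2. The latter is the decay y^(-σ/2), which is given away since only boundedness is
    -- wanted.
    x^¾-scale : ∀ {B σ} → 0# < B → 0# ≤ σ → B * y ^ (σ - 1#) ≤ x →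
      x ⁻¹ * y ⁻¹ * (x ^ (ι 3 / ι 4) * y ^ (ι 3 / ι 4 - σ / ι 4)) ≤ exp (- (log B * ι 4 ⁻¹))
    x^¾-scale {B} {σ} 0<B 0≤σ Byσ≤x = R.begin
      x ⁻¹ * y ⁻¹ * (x ^ a * y ^ b)       R.≈⟨ *-cong ⁻¹*⁻¹≈monomial (^*^≈monomial a b) ⟩
      monomial (- 1#) (- 1#) * monomial a b R.≈⟨ monomial-* (- 1#) (- 1#) a b ⟩
      monomial (- 1# + a) (- 1# + b)       R.≤⟨ exp-mono-≤ exponent ⟩
      exp (- (log B * f))                  R.∎
      where
      a = ι 3 / ι 4
      b = ι 3 / ι 4 - σ / ι 4

      log-hypothesis : log B + (σ - 1#) * ν ≤ ℓ
      log-hypothesis = exp-cancel-≤ (R.begin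
        exp (log B + (σ - 1#) * ν)        R.≈⟨ exp-+ (log B) ((σ - 1#) * ν) ⟩
        exp (log B) * exp ((σ - 1#) * ν)  R.≈⟨ *-cong (exp-log 0<B) (sym (^≈exp (σ - 1#) 0<y)) ⟩
        B * y ^ (σ - 1#)                  R.≤⟨ Byσ≤x ⟩
        x                                 R.≈⟨ exp-log 0<x ⟨
        exp ℓ                             R.∎)

      0≤f = proj₁ (⁻¹-pos (0<ι[1+n] 3))

      exponent : (- 1# + a) * ℓ + (- 1# + b) * ν ≤ - (log B * f)
      exponent = ≤-from-difference
        (+-nonNeg (*-nonNeg 0≤f (x≤y⇒0≤y-x log-hypothesis))
                  (*-nonNeg (*-nonNeg (+-nonNeg 0≤σ 0≤σ) 0≤f) 0≤log))
        (≈-from-multiple (ℓ + ν) (sym 4f≈1)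
          (solve 5 (λ B f σ ℓ ν →
             (:- (B :* f) :- ((:- :1 :+ :ι 3 :* f) :* ℓ :+ (:- :1 :+ (:ι 3 :* f :- σ :* f)) :* ν))
               :- (f :* (ℓ :- (B :+ (σ :- :1) :* ν)) :+ (σ :+ σ) :* f :* ν)
             := (ℓ :+ ν) :* (:1 :- :ι 4 :* f)) refl (log B) f σ ℓ ν))

    x^¾-square : ∀ k σ →
      x ⁻¹ * y ⁻¹ * (k * (x ^ (ι 3 / ι 4) * y ^ (ι 3 / ι 4 - σ / ι 4)) *
                     (k * (x ^ (ι 3 / ι 4) * y ^ (ι 3 / ι 4 - σ / ι 4))))
      ≈ k * k * (x ^ ½ * y ^ (½ - σ / ι 2))
    x^¾-square k σ = trans (reciprocal-scaled-square k (ι 3 / ι 4) (ι 3 / ι 4 - σ / ι 4))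
      (*-congˡ (trans (monomial-cong eq₁ eq₂) (sym (^*^≈monomial ½ (½ - σ / ι 2)))))
      where
      -- To the solver the reciprocals of 4 and 2 are unrelated atoms; this equation links them.
      2f≈h : ι 2 * f ≈ h
      2f≈h = sym (⁻¹-unique (trans (solve 1 (λ f → :ι 2 :* (:ι 2 :* f) := :ι 4 :* f) refl f) 4f≈1))
      6f-1≈h : ι 3 * f + ι 3 * f - 1# ≈ h
      6f-1≈h = trans (≈-from-multiple 1# 4f≈1
        (solve 1 (λ f → (:ι 3 :* f :+ :ι 3 :* f :- :1) :- :ι 2 :* f := :1 :* (:ι 4 :* f :- :1)) refl f)) 2f≈h
      eq₁ : ι 3 * f + ι 3 * f - 1# ≈ 1# * h
      eq₁ = trans 6f-1≈h (sym (*-identityˡ h))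
      eq₂ : (ι 3 * f - σ * f) + (ι 3 * f - σ * f) - 1# ≈ 1# * h - σ * h
      eq₂ = trans (solve 2 (λ f σ → (:ι 3 :* f :- σ :* f) :+ (:ι 3 :* f :- σ :* f) :- :1
                                 := (:ι 3 :* f :+ :ι 3 :* f :- :1) :- σ :* (:ι 2 :* f)) refl f σ)
                  (+-cong eq₁ (-‿cong (*-congˡ 2f≈h)))

    x^½-square : ∀ k ε →
      x ⁻¹ * y ⁻¹ * (k * (x ^ ½ * y ^ (1# + ε / ι 2)) * (k * (x ^ ½ * y ^ (1# + ε / ι 2)))) ≈ k * k * y ^ (1# + ε)
    x^½-square k ε = trans (reciprocal-scaled-square k ½ (1# + ε / ι 2))
      (*-congˡ (trans (exp-cong eq) (sym (^≈exp (1# + ε) 0<y))))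
      where
      eq : (½ + ½ - 1#) * ℓ + (1# + ε / ι 2 + (1# + ε / ι 2) - 1#) * ν ≈ (1# + ε) * ν
      eq = ≈-from-multiple (ℓ + ε * ν) 2h≈1
        (solve 4 (λ h ε ℓ ν → ((:1 :* h :+ :1 :* h :- :1) :* ℓ :+ (:1 :+ ε :* h :+ (:1 :+ ε :* h) :- :1) :* ν)
                    :- (:1 :+ ε) :* ν := (ℓ :+ ε :* ν) :* (:ι 2 :* h :- :1)) refl h ε ℓ ν)

  -- For x ≥ 0 the tangent at x, evaluated at 0, gives exp x - 1 ≤ x exp x. For x ≤ 0 the tangent at
  -- 0 gives x (exp x - 1) ≤ x².
  x[eˣ-1]≤eˢx² : ∀ {x S} → x ≤ S → 0# ≤ S → x * (exp x - 1#) ≤ exp S * (x * x)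
  x[eˣ-1]≤eˢx² {x} {S} x≤S 0≤S with ≤-total 0# x
  ... | inj₁ 0≤x = ≤-from-difference
    (+-nonNeg (*-nonNeg 0≤x (x≤y⇒0≤y-x (exp-tangent x 0#)))
              (*-nonNeg (*-nonNeg 0≤x 0≤x) (x≤y⇒0≤y-x (exp-mono-≤ x≤S))))
    (≈-from-multiple (- x) exp0≈1
      (solve 4 (λ x e E z → E :* (x :* x) :- x :* (e :- :1) :-
                 (x :* (z :- e :* (:1 :+ (:0 :- x))) :+ x :* x :* (E :- e)) := (:- x) :* (z :- :1))
        refl x (exp x) (exp S) (exp 0#)))
  ... | inj₂ x≤0 = ≤-from-difference
    (+-nonNeg (*-nonNeg (x≤y⇒0≤y-x x≤0) (x≤y⇒0≤y-x (1+x≤expx x)))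
              (*-nonNeg (square-nonNeg x) (x≤y⇒0≤y-x (≤-respˡ exp0≈1 (exp-mono-≤ 0≤S)))))
    (solve 3 (λ x e E → E :* (x :* x) :- x :* (e :- :1) :=
                 (:0 :- x) :* (e :- (:1 :+ x)) :+ x :* x :* (E :- :1)) refl x (exp x) (exp S))

  -- Second-order Taylor estimate for the logistic function at the point where it
  -- equals p; its derivative there is p (1 - p).
  logistic-expansion : ∀ {p x S} → 0# < p → 0# < 1# - p → x ≤ S → - x ≤ S → 0# ≤ S →
    let a = p / (1# - p) in
    abs (a * exp x / (1# + a * exp x) - (p + p * (1# - p) * x)) ≤ p * (1# - p) * (exp S * exp S * (x * x))
  logistic-expansion {p} {x} {S} 0<p 0<m x≤S -x≤S 0≤S =
    -- Of the two factors `E` in the bound, one pays for dropping `w` (from 1 ≤ E w), the other for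
    -- x u ≤ E x².
    abs-lub (absorb-factor 1≤Ew 0≤bound (≤-respˡ (sym (trans (*-assoc E w r) (*-congˡ wr≈))) upper))
            (absorb-factor 1≤Ew 0≤bound (≤-respˡ (sym (trans (*-assoc E w (- r)) (*-congˡ w[-r]≈))) lower))
    where
    m = 1# - p
    a = p / m
    e = exp x
    E = exp S
    D = 1# + a * e
    L = p * m
    t = a * e / D
    r = t - (p + L * x)
    -- The logistic value `t` equals p e / w. Multiplied by `w`, the remainder `r` becomes a
    -- polynomial in `p`, `x` and `u`.
    w = m + p * e
    u = e - 1#
    0≤p = proj₁ 0<p
    0≤m = proj₁ 0<m
    0≤L = *-nonNeg 0≤p 0≤m
    0≤E = proj₁ (exp-pos S)
    bound = L * (E * E * (x * x))
    0≤bound : 0# ≤ bound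
    0≤bound = *-nonNeg 0≤L (*-nonNeg (*-nonNeg 0≤E 0≤E) (square-nonNeg x))

    am≈p : a * m ≈ p
    am≈p = ≈-from-multiple p (⁻¹-inverseʳ (0<x⇒x≉0 0<m))
      (solve 3 (λ p m i → p :* i :* m :- p := p :* (m :* i :- :1)) refl p m (m ⁻¹))

    0<D : 0# < D
    0<D = +-pos-nonNeg 0<1 (*-nonNeg (*-nonNeg 0≤p (proj₁ (⁻¹-pos 0<m))) (proj₁ (exp-pos x)))

    wt≈pe : w * t ≈ p * e
    wt≈pe = R.begin-equality
      w * t                    R.≈⟨ *-congʳ (+-congˡ (*-congʳ am≈p)) ⟨
      (m + a * m * e) * t      R.≈⟨ solve 4 (λ m a e i → (m :+ a :* m :* e) :* (a :* e :* i)
                                   := a :* m :* e :* ((:1 :+ a :* e) :* i)) refl m a e (D ⁻¹) ⟩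
      a * m * e * (D * D ⁻¹)   R.≈⟨ *-cong (*-congʳ am≈p) (⁻¹-inverseʳ (0<x⇒x≉0 0<D)) ⟩
      p * e * 1#               R.≈⟨ *-identityʳ _ ⟩
      p * e                    R.∎

    wr≈ : w * r ≈ L * (u - x - p * (x * u))
    wr≈ = ≈-from-multiple 1# wt≈pe
      (solve 4 (λ p x e t →
         (:1 :- p :+ p :* e) :* (t :- (p :+ p :* (:1 :- p) :* x))
           :- p :* (:1 :- p) :* ((e :- :1) :- x :- p :* (x :* (e :- :1)))
         := :1 :* ((:1 :- p :+ p :* e) :* t :- p :* e)) refl p x e t)

    w[-r]≈ : w * - r ≈ L * - (u - x - p * (x * u))
    w[-r]≈ = trans (solve 2 (λ w r → w :* (:- r) := :- (w :* r)) refl w r)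
      (trans (-‿cong wr≈) (solve 2 (λ L v → :- (L :* v) := L :* (:- v)) refl L _))

    -- The tangents at 0 and at x place u - x between 0 and x u. As 0 < p < 1, both signs of u - x -
    -- p x u are then at most x u.
    x≤u : 0# ≤ u - x
    x≤u = ≤-respʳ (solve 2 (λ e x → e :- (:1 :+ x) := e :- :1 :- x) refl e x) (x≤y⇒0≤y-x (1+x≤expx x))

    u-x≤xu : 0# ≤ x * u - (u - x)
    u-x≤xu = ≤-respʳ
      (≈-from-multiple 1# exp0≈1
        (solve 3 (λ e x z → z :- e :* (:1 :+ (:0 :- x)) :- (x :* (e :- :1) :- (e :- :1 :- x)) := :1 :* (z :- :1)) refl e x (exp 0#)))
      (x≤y⇒0≤y-x (exp-tangent x 0#))

    0≤xu : 0# ≤ x * u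
    0≤xu = ≤-respʳ (solve 2 (λ d v → d :+ (v :- d) := v) refl (u - x) (x * u)) (+-nonNeg x≤u u-x≤xu)

    scale : ∀ {v} → v ≤ x * u → E * (L * v) ≤ bound
    scale {v} v≤xu = R.begin
      E * (L * v)              R.≤⟨ *-monoʳ-≤-nonNeg 0≤E (*-monoʳ-≤-nonNeg 0≤L (≤-trans v≤xu (x[eˣ-1]≤eˢx² x≤S 0≤S))) ⟩
      E * (L * (E * (x * x)))  R.≈⟨ solve 3 (λ E L y → E :* (L :* (E :* y)) := L :* (E :* E :* y)) refl E L (x * x) ⟩
      bound                    R.∎

    upper = scale (≤-from-difference (+-nonNeg u-x≤xu (*-nonNeg 0≤p 0≤xu))
      (solve 3 (λ d p v → v :- (d :- p :* v) := v :- d :+ p :* v) refl (u - x) p (x * u)))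
    lower = scale (≤-from-difference (+-nonNeg x≤u (*-nonNeg 0≤m 0≤xu))
      (solve 3 (λ d p v → v :- (:- (d :- p :* v)) := d :+ (:1 :- p) :* v) refl (u - x) p (x * u)))

    1≤Ee : 1# ≤ E * e
    1≤Ee = ≤-respˡ exp0≈1 (≤-respʳ (exp-+ S x) (exp-mono-≤
      (≤-from-difference (x≤y⇒0≤y-x -x≤S) (solve 2 (λ S x → S :+ x :- :0 := S :- (:- x)) refl S x))))

    -- E w = m E + p (E e) is at least m + p = 1, since both E and E e are at least 1.
    1≤Ew : 1# ≤ E * w
    1≤Ew = ≤-from-difference
      (+-nonNeg (*-nonNeg 0≤m (x≤y⇒0≤y-x (≤-respˡ exp0≈1 (exp-mono-≤ 0≤S)))) (*-nonNeg 0≤p (x≤y⇒0≤y-x 1≤Ee)))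
      (solve 3 (λ p e E → E :* (:1 :- p :+ p :* e) :- :1 := (:1 :- p) :* (E :- :1) :+ p :* (E :* e :- :1)) refl p e E)

-- Vector norms and coercive matrices.

module Norms (ℛ : RealNumbers) where
  open RealAnalysis ℛ
  open OrderedField ℛ
  open LinearAlgebra ℛ
  open Exponential ℛ
  private module R = PartialOrderReasoning poset

  ‖‖∞-nonNeg : ∀ {n} (x : Vector ℝ n) → 0# ≤ ‖ x ‖∞
  ‖‖∞-nonNeg {zero}  x = ≤-refl
  ‖‖∞-nonNeg {suc n} x = ≤-trans (‖‖∞-nonNeg (x ∘ suc)) (y≤x⊔y _ _)

  abs≤‖‖∞ : ∀ {n} (x : Vector ℝ n) j → abs (x j) ≤ ‖ x ‖∞
  abs≤‖‖∞ x zero    = x≤x⊔y _ _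
  abs≤‖‖∞ x (suc j) = ≤-trans (abs≤‖‖∞ (x ∘ suc) j) (y≤x⊔y _ _)

  ‖‖∞-lub : ∀ {n} {x : Vector ℝ n} {b} → 0# ≤ b → (∀ j → abs (x j) ≤ b) → ‖ x ‖∞ ≤ b
  ‖‖∞-lub {zero}  0≤b x≤b = 0≤b
  ‖‖∞-lub {suc n} 0≤b x≤b = ⊔-lub (x≤b zero) (‖‖∞-lub 0≤b (x≤b ∘ suc))

  ‖‖₂-nonNeg : ∀ {n} (x : Vector ℝ n) → 0# ≤ ‖ x ‖₂
  ‖‖₂-nonNeg x with ⟪ x , x ⟫ ≤? 0#
  ... | yes _ = ≤-refl
  ... | no _  = proj₁ (exp-pos _)

  ‖‖₂-square : ∀ {n} (x : Vector ℝ n) → ‖ x ‖₂ * ‖ x ‖₂ ≈ ⟪ x , x ⟫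
  ‖‖₂-square x = sqrt-square (⟪x,x⟫-nonNeg x)

  square-≤-from-abs : ∀ {x b} → abs x ≤ b → x * x ≤ b * b
  square-≤-from-abs {x} |x|≤b = ≤-respˡ (abs-square x)
    (*-mono-≤-nonNeg (abs-nonNeg x) (≤-trans (abs-nonNeg x) |x|≤b) |x|≤b |x|≤b)

  ⟪x,x⟫≤n*b² : ∀ {n} (x : Vector ℝ n) {b} → (∀ j → abs (x j) ≤ b) → ⟪ x , x ⟫ ≤ ι n * (b * b)
  ⟪x,x⟫≤n*b² {n} x {b} x≤b = ≤-respʳ (sum-const n (b * b)) (sum-mono-≤ (λ j → square-≤-from-abs (x≤b j)))

  ⟪⟫-square-expand : ∀ {n} a b (x y : Vector ℝ n) → let z = λ j → a * x j + b * y j in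
    ⟪ z , z ⟫ ≈ a * a * ⟪ x , x ⟫ + (a * b + a * b) * ⟪ x , y ⟫ + b * b * ⟪ y , y ⟫
  ⟪⟫-square-expand a b x y = R.begin-equality
    ⟪ z , z ⟫
      R.≈⟨ ⟪⟫-linearʳ a b z x y ⟩
    a * ⟪ z , x ⟫ + b * ⟪ z , y ⟫
      R.≈⟨ +-cong (*-congˡ (trans (⟪⟫-comm z x) (⟪⟫-linearʳ a b x x y)))
                  (*-congˡ (trans (⟪⟫-comm z y) (⟪⟫-linearʳ a b y x y))) ⟩
    a * (a * ⟪ x , x ⟫ + b * ⟪ x , y ⟫) + b * (a * ⟪ y , x ⟫ + b * ⟪ y , y ⟫)
      R.≈⟨ +-congˡ (*-congˡ (+-congʳ (*-congˡ (⟪⟫-comm y x)))) ⟩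
    a * (a * ⟪ x , x ⟫ + b * ⟪ x , y ⟫) + b * (a * ⟪ x , y ⟫ + b * ⟪ y , y ⟫)
      R.≈⟨ solve 5 (λ a b X P Y → a :* (a :* X :+ b :* P) :+ b :* (a :* P :+ b :* Y)
                     := a :* a :* X :+ (a :* b :+ a :* b) :* P :+ b :* b :* Y)
             refl a b ⟪ x , x ⟫ ⟪ x , y ⟫ ⟪ y , y ⟫ ⟩
    a * a * ⟪ x , x ⟫ + (a * b + a * b) * ⟪ x , y ⟫ + b * b * ⟪ y , y ⟫ R.∎
    where z = λ j → a * x j + b * y j

  -- Cauchy-Schwarz against the all-ones vector 1: with s the sum, ‖s 1 - N x‖₂² = N (N ‖x‖₂² - s²).
  -- Size zero is separate because N is cancelled.
  sum-square-≤ : ∀ {n} (x : Vector ℝ n) → sum x * sum x ≤ ι n * ⟪ x , x ⟫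
  sum-square-≤ {zero}  x = ≤-reflexive (trans (zeroˡ 0#) (sym (zeroˡ 0#)))
  sum-square-≤ {suc n} x = *-cancelˡ-≤-pos (0<ι[1+n] n) (≤-from-difference (⟪x,x⟫-nonNeg z) (sym (R.begin-equality
    ⟪ z , z ⟫
      R.≈⟨ ⟪⟫-square-expand s (- N) one x ⟩
    s * s * ⟪ one , one ⟫ + (s * - N + s * - N) * ⟪ one , x ⟫ + (- N) * (- N) * ⟪ x , x ⟫
      R.≈⟨ +-congʳ (+-cong (*-congˡ (sum-const (suc n) (1# * 1#))) (*-congˡ (sum-cong (λ j → *-identityˡ (x j))))) ⟩
    s * s * (N * (1# * 1#)) + (s * - N + s * - N) * s + (- N) * (- N) * ⟪ x , x ⟫
      R.≈⟨ solve 3 (λ s N X → s :* s :* (N :* (:1 :* :1)) :+ (s :* (:- N) :+ s :* (:- N)) :* s :+ (:- N) :* (:- N) :* X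
                     := N :* (N :* X) :- N :* (s :* s)) refl s N ⟪ x , x ⟫ ⟩
    N * (N * ⟪ x , x ⟫) - N * (s * s) R.∎)))
    where
    s = sum x
    N = ι (suc n)
    one : Vector ℝ (suc n)
    one _ = 1#
    z = λ j → s * one j + (- N) * x j

  abs-sum-≤ : ∀ {n} {x b : Vector ℝ n} → (∀ j → abs (x j) ≤ b j) → abs (sum x) ≤ sum b
  abs-sum-≤ {zero}  x≤b = abs-lub ≤-refl (≤-reflexive (solve 0 (:- :0 := :0) refl))
  abs-sum-≤ {suc n} x≤b = abs-+-≤ (x≤b zero) (abs-sum-≤ (x≤b ∘ suc))

  Coercive : ∀ {n} → ℝ → Matrix n → Set
  Coercive c A = ∀ x → c * ⟪ x , x ⟫ ≤ ⟪ x , A ∙ x ⟫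

  -- ‖v‖₂² - c² ‖y‖₂² equals ‖c y - v‖₂² + 2c (⟪y , v⟫ - c ‖y‖₂²), so neither Cauchy-Schwarz nor a
  -- square root is involved.
  coercive⇒solution-bound : ∀ {n c} {A : Matrix n} → 0# ≤ c → Coercive c A →
    ∀ {y v} → (∀ j → (A ∙ y) j ≈ v j) → c * c * ⟪ y , y ⟫ ≤ ⟪ v , v ⟫
  coercive⇒solution-bound {c = c} 0≤c coercive {y} {v} Ay≈v = ≤-from-difference
    (+-nonNeg (⟪x,x⟫-nonNeg z) (*-nonNeg (+-nonNeg 0≤c 0≤c)
      (x≤y⇒0≤y-x (≤-respʳ (⟪⟫-congʳ y Ay≈v) (coercive y)))))
    (sym (trans (+-congʳ (⟪⟫-square-expand c (- 1#) y v))
      (solve 4 (λ c Y P V → c :* c :* Y :+ (c :* (:- :1) :+ c :* (:- :1)) :* P :+ (:- :1) :* (:- :1) :* V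
                              :+ (c :+ c) :* (P :- c :* Y)
                     := V :- c :* c :* Y) refl c ⟪ y , y ⟫ ⟪ y , v ⟫ ⟪ v , v ⟫)))
    where z = λ j → c * y j + (- 1#) * v j

  -- Coercivity tested on the unit vector `identity j`.
  coercive⇒diagonal-≥ : ∀ {n c} {A : Matrix n} → Coercive c A → ∀ j → c ≤ A j j
  coercive⇒diagonal-≥ {c = c} {A} coercive j = R.begin
    c                                R.≈⟨ *-identityʳ c ⟨
    c * 1#                           R.≈⟨ *-congˡ (trans (identity-∙ (identity j) j) (identity-diagonal j)) ⟨
    c * ⟪ identity j , identity j ⟫  R.≤⟨ coercive (identity j) ⟩
    ⟪ identity j , A ∙ identity j ⟫  R.≈⟨ identity-∙ (A ∙ identity j) j ⟩
    ⟪ A j , identity j ⟫             R.≈⟨ ⟪⟫-comm (A j) (identity j) ⟩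
    ⟪ identity j , A j ⟫             R.≈⟨ identity-∙ (A j) j ⟩
    A j j                            R.∎

-- The signless Laplacian and the size of solutions of its systems.

module SignlessLaplacian (ℛ : RealNumbers) {n : ℕ} (G : Graph n) where
  open RealAnalysis ℛ
  open OrderedField ℛ
  open LinearAlgebra ℛ
  open Norms ℛ
  open Graph G
  private module R = PartialOrderReasoning poset

  adjacency : Matrix n
  adjacency j k = if adj j k then 1# else 0#

  if-then-0≈adjacency-* : ∀ j k x → (if adj j k then x else 0#) ≈ adjacency j k * x
  if-then-0≈adjacency-* j k x with adj j k
  ... | true  = sym (*-identityˡ x)
  ... | false = sym (zeroˡ x)

  abs-adjacency-*-≤ : ∀ j k {x b} → abs x ≤ b → abs (adjacency j k * x) ≤ b
  abs-adjacency-*-≤ j k {x} {b} |x|≤b with adj j k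
  ... | true  = ≤-respʳ (*-identityˡ b) (abs-*-≤ 1# 0≤1 |x|≤b)
  ... | false = ≤-trans (≤-respʳ (zeroˡ b) (abs-*-≤ 0# ≤-refl |x|≤b)) (≤-trans (abs-nonNeg x) |x|≤b)

  ι-sum : ∀ {m} (f : Fin m → ℕ) → ι (ℕ-Sum.sum f) ≈ sum (ι ∘ f)
  ι-sum {zero}  f = refl
  ι-sum {suc m} f = trans (MonoidMult.×-homo-+ +-monoid 1# (f zero) (ℕ-Sum.sum (f ∘ suc))) (+-congˡ (ι-sum (f ∘ suc)))

  ι-degree : ∀ j → ι (degree j) ≈ sum (adjacency j)
  ι-degree j = trans (ι-sum (λ k → if adj j k then 1 else 0)) (sum-cong indicator)
    where
    indicator : ∀ k → ι (if adj j k then 1 else 0) ≈ adjacency j k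
    indicator k with adj j k
    ... | true  = +-identityʳ 1#
    ... | false = refl

  Q : Matrix n
  Q = signlessLaplacian G

  Q-diagonal : ∀ j → Q j j ≈ ι (degree j)
  Q-diagonal j with j Fin.≟ j
  ... | yes _  = refl
  ... | no j≢j = contradiction ≡.refl j≢j

  Q-sym : IsSymmetric Q
  Q-sym j k with j Fin.≟ k | k Fin.≟ j
  ... | yes ≡.refl | yes _   = refl
  ... | yes j≡k    | no k≢j  = contradiction (≡.sym j≡k) k≢j
  ... | no j≢k     | yes k≡j = contradiction (≡.sym k≡j) j≢k
  ... | no _       | no _    rewrite symm j k = refl

  Q-split : ∀ j k → Q j k ≈ ι (degree j) * identity j k + 1# * adjacency j k
  Q-split j k with j Fin.≟ k
  ... | yes ≡.refl rewrite irrefl j = solve 1 (λ g → g := g :* :1 :+ :1 :* :0) refl (ι (degree j))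
  ... | no _ = solve 2 (λ g a → a := g :* :0 :+ :1 :* a) refl (ι (degree j)) (adjacency j k)

  Q-∙ : ∀ x j → (Q ∙ x) j ≈ ι (degree j) * x j + (adjacency ∙ x) j
  Q-∙ x j = R.begin-equality
    (Q ∙ x) j
      R.≈⟨ sum-cong (λ k → trans (*-congʳ (Q-split j k))
             (solve 4 (λ g i a x → (g :* i :+ :1 :* a) :* x := g :* (i :* x) :+ :1 :* (a :* x))
                refl (ι (degree j)) (identity j k) (adjacency j k) (x k))) ⟩
    sum (λ k → ι (degree j) * (identity j k * x k) + 1# * (adjacency j k * x k))
      R.≈⟨ sum-linear (ι (degree j)) 1# (λ k → identity j k * x k) (λ k → adjacency j k * x k) ⟩
    ι (degree j) * (identity ∙ x) j + 1# * (adjacency ∙ x) j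
      R.≈⟨ +-cong (*-congˡ (identity-∙ x j)) (*-identityˡ _) ⟩
    ι (degree j) * x j + (adjacency ∙ x) j R.∎

  -- The reason why Q governs the problem: λ_jk depends on β_j + β_k, so its linear part summed over
  -- the neighbours of j is a row of Q.
  Q-∙-edges : ∀ x j → (Q ∙ x) j ≈ sum (λ k → adjacency j k * (x j + x k))
  Q-∙-edges x j = R.begin-equality
    (Q ∙ x) j                                       R.≈⟨ Q-∙ x j ⟩
    ι (degree j) * x j + (adjacency ∙ x) j          R.≈⟨ +-congʳ (trans (*-comm _ _) (*-congˡ (ι-degree j))) ⟩
    x j * sum (adjacency j) + (adjacency ∙ x) j     R.≈⟨ +-congˡ (sym (*-identityˡ _)) ⟩
    x j * sum (adjacency j) + 1# * (adjacency ∙ x) j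
      R.≈⟨ sum-linear (x j) 1# (adjacency j) (λ k → adjacency j k * x k) ⟨
    sum (λ k → x j * adjacency j k + 1# * (adjacency j k * x k))
      R.≈⟨ sum-cong (λ k → solve 3 (λ x a y → x :* a :+ :1 :* (a :* y) := a :* (x :+ y)) refl (x j) (adjacency j k) (x k)) ⟩
    sum (λ k → adjacency j k * (x j + x k)) R.∎

  module _ {τ : ℝ} (0<τ : 0# < τ) (0<n : 0# < ι n) (coercive : Coercive (τ * ι n) Q) where

    private
      N = ι n
      0≤τ = proj₁ 0<τ
      0≤τN = *-nonNeg 0≤τ (proj₁ 0<n)

    Q-injective : ∀ {x} → (∀ j → (Q ∙ x) j ≈ 0#) → ∀ j → x j ≈ 0#
    Q-injective {x} Qx≈0 j = square≈0⇒≈0 (≤-antisym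
      (≤-trans (term≤sum (λ k → square-nonNeg (x k)) j)
        (*-cancelˡ-≤-pos (*-pos 0<τN 0<τN)
          (≤-respʳ (trans (sum-zero {n} (λ _ → zeroˡ 0#)) (sym (zeroʳ _)))
            (coercive⇒solution-bound {A = Q} 0≤τN coercive {x} {λ _ → 0#} Qx≈0))))
      (square-nonNeg (x j)))
      where 0<τN = *-pos 0<τ 0<n

    Q-solvable : Solvable Q
    Q-solvable = [ (λ (x , (j , xⱼ≉0) , Qx≈0) → contradiction (Q-injective {x} Qx≈0 j) xⱼ≉0) , id ]′
                   (singular-or-solvable Q)

    module _ {y v : Vector ℝ n} (Qy≈v : ∀ j → (Q ∙ y) j ≈ v j) where

      solution-‖‖₂ : τ * τ * (N * N) * ⟪ y , y ⟫ ≤ ⟪ v , v ⟫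
      solution-‖‖₂ = ≤-respˡ (solve 3 (λ t N Y → t :* N :* (t :* N) :* Y := t :* t :* (N :* N) :* Y) refl τ N ⟪ y , y ⟫)
        (coercive⇒solution-bound {A = Q} 0≤τN coercive {y} {v} Qy≈v)

      module _ {D : ℝ} (0≤D : 0# ≤ D) (v≤D : ∀ j → abs (v j) ≤ D) where

        private S = sum (λ j → abs (y j))

        τ*‖y‖₁≤D : τ * S ≤ D
        τ*‖y‖₁≤D = square-cancel-≤ 0≤D (*-cancelˡ-≤-pos 0<n (R.begin
          N * (τ * S * (τ * S))                     R.≈⟨ solve 3 (λ N t S → N :* (t :* S :* (t :* S)) := N :* (t :* t) :* (S :* S)) refl N τ S ⟩
          N * (τ * τ) * (S * S)                     R.≤⟨ *-monoʳ-≤-nonNeg (*-nonNeg (proj₁ 0<n) (*-nonNeg 0≤τ 0≤τ)) (sum-square-≤ (λ j → abs (y j))) ⟩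
          N * (τ * τ) * (N * sum (λ j → abs (y j) * abs (y j)))
                                                    R.≈⟨ *-congˡ (*-congˡ (sum-cong (λ j → abs-square (y j)))) ⟩
          N * (τ * τ) * (N * ⟪ y , y ⟫)             R.≈⟨ solve 3 (λ N t Y → N :* (t :* t) :* (N :* Y) := t :* t :* (N :* N) :* Y) refl N τ ⟪ y , y ⟫ ⟩
          τ * τ * (N * N) * ⟪ y , y ⟫               R.≤⟨ solution-‖‖₂ ⟩
          ⟪ v , v ⟫                                 R.≤⟨ ⟪x,x⟫≤n*b² v v≤D ⟩
          N * (D * D)                               R.∎))

        private
          0≤S : 0# ≤ S
          0≤S = sum-nonNeg (λ j → abs-nonNeg (y j))

          diagonal-term : ∀ j → abs (ι (degree j) * y j) ≤ D + S
          diagonal-term j = ≤-respˡ (abs-cong (≈-from-multiple 1# (trans (sym (Qy≈v j)) (Q-∙ y j))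
              (solve 3 (λ v s gy → v :+ (:- s) :- gy := :1 :* (v :- (gy :+ s))) refl (v j) ((adjacency ∙ y) j) (ι (degree j) * y j))))
            (abs-+-≤ (v≤D j) (abs-neg-≤ (abs-sum-≤ {x = λ k → adjacency j k * y k} {b = λ k → abs (y k)} (λ k → abs-adjacency-*-≤ j k ≤-refl))))

          one-sided : ∀ j r → ι (degree j) * r ≤ D + S → r ≤ (τ * τ) ⁻¹ * (1# + τ) * (N ⁻¹ * D)
          one-sided j r gr≤ = ≤-respʳ
            (solve 4 (λ n t u D → n :* (t :* (u :* D)) := t :* u :* (n :* D)) refl (N ⁻¹) ((τ * τ) ⁻¹) (1# + τ) D)
            -- One τ joins N as the lower bound on the degree; the other turns S into at most D.
            -- Hence the constant (1 + τ) / τ².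
            (c*x≤y⇒x≤c⁻¹*y 0<n (c*x≤y⇒x≤c⁻¹*y (*-pos 0<τ 0<τ) (R.begin
              τ * τ * (N * r)    R.≈⟨ solve 3 (λ t N r → t :* t :* (N :* r) := t :* (t :* N :* r)) refl τ N r ⟩
              τ * (τ * N * r)    R.≤⟨ *-monoʳ-≤-nonNeg 0≤τ (replace-factor 0≤τN
                                       (≤-respʳ (Q-diagonal j) (coercive⇒diagonal-≥ {A = Q} coercive j)) (+-nonNeg 0≤D 0≤S) gr≤) ⟩
              τ * (D + S)        R.≈⟨ distribˡ τ D S ⟩
              τ * D + τ * S      R.≤⟨ +-mono-≤ ≤-refl τ*‖y‖₁≤D ⟩
              τ * D + D          R.≈⟨ solve 2 (λ t D → t :* D :+ D := (:1 :+ t) :* D) refl τ D ⟩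
              (1# + τ) * D       R.∎)))

        solution-‖‖∞ : ∀ j → abs (y j) ≤ (τ * τ) ⁻¹ * (1# + τ) * (N ⁻¹ * D)
        solution-‖‖∞ j = abs-lub
          (one-sided j (y j) (≤-trans (x≤abs _) (diagonal-term j)))
          (one-sided j (- y j) (≤-respˡ (solve 2 (λ g y → :- (g :* y) := g :* (:- y)) refl (ι (degree j)) (y j))
            (≤-trans (-x≤abs _) (diagonal-term j))))

-- Expansion of the expected degrees and the resulting bounds on δ.

module DegreeApproximation (ℛ : RealNumbers) {n : ℕ} (G : Graph n) (d : Fin n → ℕ) where
  open RealAnalysis ℛ
  open OrderedField ℛ
  open LinearAlgebra ℛ
  open Exponential ℛ
  open Norms ℛ
  open SignlessLaplacian ℛ G
  open DegreeSequence G d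
  private module R = PartialOrderReasoning poset

  module _ (0<Λ : 0# < Λ) where

    private
      p = density
      N = ι n

    -- Λ = p - p² would be nonpositive for p ≤ 0. With the next lemma this puts the density strictly
    -- between 0 and 1, so the odds have a logarithm.
    density-pos : 0# < p
    density-pos = ≰⇒> λ p≤0 → <⇒≱ 0<Λ (≤-from-difference
      (+-nonNeg (x≤y⇒0≤y-x p≤0) (square-nonNeg p))
      (solve 1 (λ p → :0 :- p :* (:1 :- p) := :0 :- p :+ p :* p) refl p))

    1-density-pos : 0# < 1# - p
    1-density-pos = ≰⇒> λ m≤0 → <⇒≱ 0<Λ (≤-from-difference
      (*-nonNeg (proj₁ density-pos) (x≤y⇒0≤y-x m≤0))
      (solve 2 (λ p m → :0 :- p :* m := p :* (:0 :- m)) refl p (1# - p)))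

    odds-pos : 0# < p / (1# - p)
    odds-pos = *-pos density-pos (⁻¹-pos 1-density-pos)

    module _ (Q⁻¹ : Matrix n) where

      exp[βⱼ+βₖ] : ∀ j k → exp (β Q⁻¹ j + β Q⁻¹ k) ≈ p / (1# - p) * exp (γ Q⁻¹ j + γ Q⁻¹ k)
      exp[βⱼ+βₖ] j k = R.begin-equality
        exp (β Q⁻¹ j + β Q⁻¹ k)
          R.≈⟨ exp-cong (trans (solve 3 (λ l x y → l :+ x :+ (l :+ y) := (l :+ l) :+ (x :+ y)) refl (½ * log a) x y)
                               (+-congʳ (½x+½x≈x (log a)))) ⟩
        exp (log a + (x + y))
          R.≈⟨ exp-+ (log a) (x + y) ⟩
        exp (log a) * exp (x + y)
          R.≈⟨ *-congʳ (exp-log odds-pos) ⟩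
        a * exp (x + y) R.∎
        where
        a = p / (1# - p)
        x = γ Q⁻¹ j
        y = γ Q⁻¹ k

      βⱼ-βₖ : ∀ j k → β Q⁻¹ j - β Q⁻¹ k ≈ γ Q⁻¹ j + - γ Q⁻¹ k
      βⱼ-βₖ j k = solve 3 (λ l x y → l :+ x :- (l :+ y) := x :+ (:- y)) refl
                    (½ * log (p / (1# - p))) (γ Q⁻¹ j) (γ Q⁻¹ k)

      remainder : Matrix n
      remainder j k = edgeProbability (β Q⁻¹) j k - (p + Λ * (γ Q⁻¹ j + γ Q⁻¹ k))

      module _ (inverse : IsInverse (signlessLaplacian G) Q⁻¹) where

        Q∙Q⁻¹∙deviation : ∀ j → (Q ∙ Q⁻¹ ∙ deviation) j ≈ deviation j
        Q∙Q⁻¹∙deviation = rightInverse-∙ {A = Q} {Q⁻¹} (proj₁ inverse) deviation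

        -- γ is chosen so that the first-order terms of the degrees cancel d.
        Λ*Q∙γ : ∀ j → Λ * (Q ∙ γ Q⁻¹) j ≈ deviation j
        Λ*Q∙γ j = R.begin-equality
          Λ * (Q ∙ γ Q⁻¹) j
            -- γ is written as Λ⁻¹ y + 0 y to fit `∙-linear`.
            R.≈⟨ *-congˡ (trans (∙-congˡ Q (λ k → sym (trans (+-congˡ (zeroˡ _)) (+-identityʳ _))) j)
                                (∙-linear Q (Λ ⁻¹) 0# y y j)) ⟩
          Λ * (Λ ⁻¹ * (Q ∙ y) j + 0# * (Q ∙ y) j)
            R.≈⟨ ≈-from-multiple ((Q ∙ y) j) (⁻¹-inverseʳ (0<x⇒x≉0 0<Λ))
                   (solve 3 (λ L i q → L :* (i :* q :+ :0 :* q) :- q := q :* (L :* i :- :1)) refl Λ (Λ ⁻¹) ((Q ∙ y) j)) ⟩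
          (Q ∙ y) j
            R.≈⟨ Q∙Q⁻¹∙deviation j ⟩
          deviation j R.∎
          where y = Q⁻¹ ∙ deviation

        δ≈remainders : ∀ j → δ (β Q⁻¹) j ≈ sum (λ k → adjacency j k * remainder j k)
        δ≈remainders j = sym (R.begin-equality
          sum (λ k → a k * remainder j k)
            R.≈⟨ sum-cong (λ k → solve 5 (λ a P p L s → a :* (P :- (p :+ L :* s))
                    := :1 :* (a :* P) :+ (:- :1) :* (p :* a :+ L :* (a :* s)))
                    refl (a k) (P k) p Λ (γ Q⁻¹ j + γ Q⁻¹ k)) ⟩
          sum (λ k → 1# * (a k * P k) + (- 1#) * (p * a k + Λ * (a k * (γ Q⁻¹ j + γ Q⁻¹ k))))
            R.≈⟨ trans (sum-linear 1# (- 1#) (λ k → a k * P k) (λ k → p * a k + Λ * (a k * (γ Q⁻¹ j + γ Q⁻¹ k))))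
                   (+-congˡ (*-congˡ (sum-linear p Λ a (λ k → a k * (γ Q⁻¹ j + γ Q⁻¹ k))))) ⟩
          1# * sum (λ k → a k * P k) + (- 1#) * (p * sum a + Λ * sum (λ k → a k * (γ Q⁻¹ j + γ Q⁻¹ k)))
            R.≈⟨ +-cong (*-congˡ (sum-cong (λ k → sym (if-then-0≈adjacency-* j k (P k)))))
                   (*-congˡ (+-cong (*-congˡ (sym (ι-degree j)))
                     (trans (*-congˡ (sym (Q-∙-edges (γ Q⁻¹) j))) (Λ*Q∙γ j)))) ⟩
          1# * sum (λ k → if adj j k then P k else 0#) + (- 1#) * (p * ι (degree j) + deviation j)
            R.≈⟨ solve 4 (λ s p g d → :1 :* s :+ (:- :1) :* (p :* g :+ (d :- p :* g)) := s :- d)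
                   refl (sum (λ k → if adj j k then P k else 0#)) p (ι (degree j)) (ι (d j)) ⟩
          δ (β Q⁻¹) j R.∎)
          where
          open Graph G using (adj; degree)
          a = adjacency j
          P = edgeProbability (β Q⁻¹) j

        module _ {Γ : ℝ} (0≤Γ : 0# ≤ Γ) (γ≤Γ : ∀ j → abs (γ Q⁻¹ j) ≤ Γ) where

          -- The factor E² of `logistic-expansion` for S = Γ + Γ, which bounds every |γ_j + γ_k|.
          K : ℝ
          K = exp (Γ + Γ) * exp (Γ + Γ)

          0≤K : 0# ≤ K
          0≤K = square-nonNeg (exp (Γ + Γ))

          remainder-≤ : ∀ j k → abs (remainder j k) ≤ Λ * (K * ((γ Q⁻¹ j + γ Q⁻¹ k) * (γ Q⁻¹ j + γ Q⁻¹ k)))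
          remainder-≤ j k = ≤-respˡ
            (abs-cong (+-congʳ (*-cong (sym (exp[βⱼ+βₖ] j k)) (⁻¹-cong (+-congˡ (sym (exp[βⱼ+βₖ] j k)))))))
            (logistic-expansion density-pos 1-density-pos
              (≤-trans (x≤abs _) s≤) (≤-trans (-x≤abs _) s≤) (+-nonNeg 0≤Γ 0≤Γ))
            where s≤ = abs-+-≤ (γ≤Γ j) (γ≤Γ k)

          -- Neighbours are enlarged to all vertices and (x + y)² to 2x² + 2y². Keeping γ_j² apart
          -- from ‖γ‖₂² lets the same bound be summed over j for one norm and maximised for the
          -- other.
          δ-≤ : ∀ j → abs (δ (β Q⁻¹) j) ≤ Λ * (K * (ι 2 * (N * (γ Q⁻¹ j * γ Q⁻¹ j) + ⟪ γ Q⁻¹ , γ Q⁻¹ ⟫)))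
          δ-≤ j = R.begin
            abs (δ (β Q⁻¹) j)
              R.≈⟨ abs-cong (δ≈remainders j) ⟩
            abs (sum (λ k → adjacency j k * remainder j k))
              R.≤⟨ abs-sum-≤ (λ k → abs-adjacency-*-≤ j k (≤-trans (remainder-≤ j k) (square-of-sum k))) ⟩
            sum (λ k → c * (g j * g j) + c * (g k * g k))
              R.≈⟨ sum-linear c c (λ _ → g j * g j) (λ k → g k * g k) ⟩
            c * sum {n} (λ _ → g j * g j) + c * ⟪ g , g ⟫
              R.≈⟨ +-congʳ (*-congˡ (sum-const n (g j * g j))) ⟩
            c * (N * (g j * g j)) + c * ⟪ g , g ⟫
              R.≈⟨ solve 4 (λ L K x y → L :* (K :* :ι 2) :* x :+ L :* (K :* :ι 2) :* y := L :* (K :* (:ι 2 :* (x :+ y))))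
                     refl Λ K (N * (g j * g j)) ⟪ g , g ⟫ ⟩
            Λ * (K * (ι 2 * (N * (g j * g j) + ⟪ g , g ⟫))) R.∎
            where
            g = γ Q⁻¹
            c = Λ * (K * ι 2)
            square-of-sum : ∀ k → Λ * (K * ((g j + g k) * (g j + g k))) ≤ c * (g j * g j) + c * (g k * g k)
            square-of-sum k = ≤-from-difference
              (*-nonNeg (proj₁ 0<Λ) (*-nonNeg 0≤K (square-nonNeg (g j - g k))))
              (solve 4 (λ L K x y → L :* (K :* :ι 2) :* (x :* x) :+ L :* (K :* :ι 2) :* (y :* y)
                          :- L :* (K :* ((x :+ y) :* (x :+ y))) := L :* (K :* ((x :- y) :* (x :- y))))
                refl Λ K (g j) (g k))

          δ-‖‖₁ : ‖ δ (β Q⁻¹) ‖₁ ≤ Λ * (K * (ι 4 * (N * ⟪ γ Q⁻¹ , γ Q⁻¹ ⟫)))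
          δ-‖‖₁ = R.begin
            ‖ δ (β Q⁻¹) ‖₁
              R.≤⟨ sum-mono-≤ δ-≤ ⟩
            sum (λ j → Λ * (K * (ι 2 * (N * (g j * g j) + ⟪ g , g ⟫))))
              R.≈⟨ sum-cong (λ j → solve 5 (λ L K N x X → L :* (K :* (:ι 2 :* (N :* x :+ X)))
                                    := L :* (K :* :ι 2) :* N :* x :+ L :* (K :* :ι 2) :* X)
                                    refl Λ K N (g j * g j) ⟪ g , g ⟫) ⟩
            sum (λ j → c * N * (g j * g j) + c * ⟪ g , g ⟫)
              R.≈⟨ sum-linear (c * N) c (λ j → g j * g j) (λ _ → ⟪ g , g ⟫) ⟩
            c * N * ⟪ g , g ⟫ + c * sum {n} (λ _ → ⟪ g , g ⟫)
              R.≈⟨ +-congˡ (*-congˡ (sum-const n ⟪ g , g ⟫)) ⟩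
            c * N * ⟪ g , g ⟫ + c * (N * ⟪ g , g ⟫)
              R.≈⟨ solve 4 (λ L K N X → L :* (K :* :ι 2) :* N :* X :+ L :* (K :* :ι 2) :* (N :* X)
                              := L :* (K :* (:ι 4 :* (N :* X)))) refl Λ K N ⟪ g , g ⟫ ⟩
            Λ * (K * (ι 4 * (N * ⟪ g , g ⟫))) R.∎
            where
            g = γ Q⁻¹
            c = Λ * (K * ι 2)

          -- Two bounds on γ are in play. The constant `Γ` only controls `K`, whereas `Γ′` may
          -- depend on the deviation and later produces the factor ‖d - λ g‖∞².
          δ-‖‖∞ : ∀ {Γ′} → (∀ j → abs (γ Q⁻¹ j) ≤ Γ′) → ‖ δ (β Q⁻¹) ‖∞ ≤ Λ * (K * (ι 4 * (N * (Γ′ * Γ′))))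
          δ-‖‖∞ {Γ′} γ≤Γ′ = ‖‖∞-lub
            (*-nonNeg 0≤Λ (*-nonNeg 0≤K (*-nonNeg (ι-nonNeg 4) (*-nonNeg (ι-nonNeg n) (square-nonNeg Γ′)))))
            (λ j → R.begin
              abs (δ (β Q⁻¹) j)
                R.≤⟨ δ-≤ j ⟩
              Λ * (K * (ι 2 * (N * (g j * g j) + ⟪ g , g ⟫)))
                R.≤⟨ *-monoʳ-≤-nonNeg 0≤Λ (*-monoʳ-≤-nonNeg 0≤K (*-monoʳ-≤-nonNeg (ι-nonNeg 2)
                       (+-mono-≤ (*-monoʳ-≤-nonNeg (ι-nonNeg n) (square-≤-from-abs (γ≤Γ′ j))) (⟪x,x⟫≤n*b² g γ≤Γ′)))) ⟩
              Λ * (K * (ι 2 * (N * (Γ′ * Γ′) + N * (Γ′ * Γ′))))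
                R.≈⟨ *-congˡ (*-congˡ (solve 1 (λ x → :ι 2 :* (x :+ x) := :ι 4 :* x) refl (N * (Γ′ * Γ′)))) ⟩
              Λ * (K * (ι 4 * (N * (Γ′ * Γ′)))) R.∎)
            where
            g = γ Q⁻¹
            0≤Λ = proj₁ 0<Λ

-- Explicit constants and the final estimates.

module Estimates (ℛ : RealNumbers) where
  open RealAnalysis ℛ
  open OrderedField ℛ
  open LinearAlgebra ℛ
  open Exponential ℛ
  open Norms ℛ
  open SemiringSum semiring using (*-distribˡ-sum)
  private module R = PartialOrderReasoning poset

  module Constants {B τ K∞ K₂ : ℝ} (0<B : 0# < B) (0<τ : 0# < τ) (0<K∞ : 0# < K∞) (0<K₂ : 0# < K₂) where

    -- `κ` comes from `solution-‖‖∞`, `ρ` is B^(-1/4) from `x^¾-scale`, and `E` is `K` at this `Γ`.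
    -- The `L` are the relative constants; multiplied by the squared constants of the hypotheses
    -- they become the absolute `M`.
    κ ρ Γ E L∞ L₁ M∞ M₁ C : ℝ
    κ  = (τ * τ) ⁻¹ * (1# + τ)
    ρ  = exp (- (log B * ι 4 ⁻¹))
    Γ  = κ * (K∞ * ρ)
    E  = exp (Γ + Γ) * exp (Γ + Γ)
    L∞ = E * (ι 4 * (κ * κ))
    L₁ = E * (ι 4 * (τ * τ) ⁻¹)
    M∞ = L∞ * (K∞ * K∞)
    M₁ = L₁ * (K₂ * K₂)
    C  = Γ + Γ

    0<τ*τ : 0# < τ * τ
    0<τ*τ = *-pos 0<τ 0<τ

    0<κ : 0# < κ
    0<κ = *-pos (⁻¹-pos 0<τ*τ) (+-pos-nonNeg 0<1 (proj₁ 0<τ))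

    0<Γ : 0# < Γ
    0<Γ = *-pos 0<κ (*-pos 0<K∞ (exp-pos _))

    0<E : 0# < E
    0<E = *-pos (exp-pos _) (exp-pos _)

    0<L∞ : 0# < L∞
    0<L∞ = *-pos 0<E (*-pos (0<ι[1+n] 3) (*-pos 0<κ 0<κ))

    0<L₁ : 0# < L₁
    0<L₁ = *-pos 0<E (*-pos (0<ι[1+n] 3) (⁻¹-pos 0<τ*τ))

    0<M∞ : 0# < M∞
    0<M∞ = *-pos 0<L∞ (*-pos 0<K∞ 0<K∞)

    0<M₁ : 0# < M₁
    0<M₁ = *-pos 0<L₁ (*-pos 0<K₂ 0<K₂)

    0<C : 0# < C
    0<C = +-pos-nonNeg 0<Γ (proj₁ 0<Γ)

    module Conclusions {σ : ℝ} (ε : ℝ) (0<σ : 0# < σ) {m : ℕ} (G : Graph (suc m)) (d : Fin (suc m) → ℕ) where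
      open DegreeSequence G d

      N : ℝ
      N = ι (suc m)

      module Bounds
        (Bnσ≤Λ : B * N ^ (σ - 1#) ≤ Λ)
        (eigenvalue-bound : ∃[ q ] (IsLeastEigenvalue (signlessLaplacian G) q × τ * N ≤ q))
        (deviation-‖‖∞ : ‖ deviation ‖∞ ≤ K∞ * (Λ ^ (ι 3 / ι 4) * N ^ (ι 3 / ι 4 - σ / ι 4)))
        (deviation-‖‖₂ : ‖ deviation ‖₂ ≤ K₂ * (Λ ^ ½ * N ^ (1# + ε / ι 2))) where

        open SignlessLaplacian ℛ G
        open DegreeApproximation ℛ G d

        0<N : 0# < N
        0<N = 0<ι[1+n] m

        0<Λ : 0# < Λ
        0<Λ = <-≤-trans (*-pos 0<B (^-pos (σ - 1#) 0<N)) Bnσ≤Λ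

        coercive : Coercive (τ * N) Q
        coercive x = let q , (_ , q-least) , τN≤q = eigenvalue-bound in
          ≤-trans (*-monoˡ-≤-nonNeg (⟪x,x⟫-nonNeg x) τN≤q) (rayleigh {A = Q} Q-sym q q-least x)

        Q⁻¹ : Matrix (suc m)
        Q⁻¹ = proj₁ (symmetric-solvable⇒inverse {A = Q} Q-sym (Q-solvable 0<τ 0<N coercive))

        Q⁻¹-inverse : IsInverse Q Q⁻¹
        Q⁻¹-inverse = proj₂ (symmetric-solvable⇒inverse {A = Q} Q-sym (Q-solvable 0<τ 0<N coercive))

        open Scales 0<Λ (1≤ι[1+n] m) using (x^¾-scale; x^¾-square; x^½-square)

        y : Vector ℝ (suc m)
        y = Q⁻¹ ∙ deviation

        Qy≈deviation : ∀ j → (Q ∙ y) j ≈ deviation j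
        Qy≈deviation = Q∙Q⁻¹∙deviation 0<Λ Q⁻¹ Q⁻¹-inverse

        D V i : ℝ
        D = ‖ deviation ‖∞
        V = ‖ deviation ‖₂
        i = Λ ⁻¹ * N ⁻¹

        0≤Λ⁻¹ : 0# ≤ Λ ⁻¹
        0≤Λ⁻¹ = proj₁ (⁻¹-pos 0<Λ)

        0≤i : 0# ≤ i
        0≤i = *-nonNeg 0≤Λ⁻¹ (proj₁ (⁻¹-pos 0<N))

        γ≤κiD : ∀ j → abs (γ Q⁻¹ j) ≤ κ * (i * D)
        γ≤κiD j = ≤-respʳ
          (solve 4 (λ L k n D → L :* (k :* (n :* D)) := k :* (L :* n :* D)) refl (Λ ⁻¹) κ (N ⁻¹) D)
          (abs-*-≤ (Λ ⁻¹) 0≤Λ⁻¹ (solution-‖‖∞ 0<τ 0<N coercive {y} {deviation} Qy≈deviation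
            (‖‖∞-nonNeg deviation) (abs≤‖‖∞ deviation) j))

        γ≤Γ : ∀ j → abs (γ Q⁻¹ j) ≤ Γ
        γ≤Γ j = ≤-trans (γ≤κiD j) (*-monoʳ-≤-nonNeg (proj₁ 0<κ) (R.begin
          i * D         R.≤⟨ *-monoʳ-≤-nonNeg 0≤i deviation-‖‖∞ ⟩
          i * (K∞ * X)  R.≈⟨ solve 3 (λ i k X → i :* (k :* X) := k :* (i :* X)) refl i K∞ X ⟩
          K∞ * (i * X)  R.≤⟨ *-monoʳ-≤-nonNeg (proj₁ 0<K∞) (x^¾-scale 0<B (proj₁ 0<σ) Bnσ≤Λ) ⟩
          K∞ * ρ        R.∎))
          where X = Λ ^ (ι 3 / ι 4) * N ^ (ι 3 / ι 4 - σ / ι 4)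

        β-spread : ∀ j k → abs (β Q⁻¹ j - β Q⁻¹ k) ≤ C
        β-spread j k = ≤-respˡ (abs-cong (sym (βⱼ-βₖ 0<Λ Q⁻¹ j k))) (abs-+-≤ (γ≤Γ j) (abs-neg-≤ (γ≤Γ k)))

        δ-‖‖∞-relative : ‖ δ (β Q⁻¹) ‖∞ ≤ L∞ * i * (D * D)
        δ-‖‖∞-relative = R.begin
          ‖ δ (β Q⁻¹) ‖∞
            R.≤⟨ δ-‖‖∞ 0<Λ Q⁻¹ Q⁻¹-inverse (proj₁ 0<Γ) γ≤Γ γ≤κiD ⟩
          Λ * (E * (ι 4 * (N * (κ * (i * D) * (κ * (i * D))))))
            R.≈⟨ solve 7 (λ L E k a b N D →
                   L :* (E :* (:ι 4 :* (N :* (k :* (a :* b :* D) :* (k :* (a :* b :* D))))))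
                   := (L :* a) :* (N :* b) :* (E :* (:ι 4 :* (k :* k)) :* (a :* b) :* (D :* D)))
                 refl Λ E κ (Λ ⁻¹) (N ⁻¹) N D ⟩
          (Λ * Λ ⁻¹) * (N * N ⁻¹) * (L∞ * i * (D * D))
            R.≈⟨ *-congʳ (*-cong (⁻¹-inverseʳ (0<x⇒x≉0 0<Λ)) (⁻¹-inverseʳ (0<x⇒x≉0 0<N))) ⟩
          1# * 1# * (L∞ * i * (D * D))
            R.≈⟨ solve 1 (λ x → :1 :* :1 :* x := x) refl (L∞ * i * (D * D)) ⟩
          L∞ * i * (D * D) R.∎

        δ-‖‖₁-relative : ‖ δ (β Q⁻¹) ‖₁ ≤ L₁ * i * (V * V)
        δ-‖‖₁-relative = R.begin
          ‖ δ (β Q⁻¹) ‖₁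
            R.≤⟨ δ-‖‖₁ 0<Λ Q⁻¹ Q⁻¹-inverse (proj₁ 0<Γ) γ≤Γ ⟩
          Λ * (E * (ι 4 * (N * ⟪ γ Q⁻¹ , γ Q⁻¹ ⟫)))
            R.≈⟨ *-congˡ (*-congˡ (*-congˡ (*-congˡ ⟪γ,γ⟫≈))) ⟩
          Λ * (E * (ι 4 * (N * (Λ ⁻¹ * Λ ⁻¹ * ⟪ y , y ⟫))))
            -- Trading Λ Λ⁻¹ for N N⁻¹ brings out N² ‖y‖₂², the quantity that coercivity bounds.
            R.≈⟨ ≈-from-multiple (E * (ι 4 * (N * Λ ⁻¹ * ⟪ y , y ⟫)))
                   (trans (⁻¹-inverseʳ (0<x⇒x≉0 0<Λ)) (sym (⁻¹-inverseʳ (0<x⇒x≉0 0<N))))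
                   (solve 6 (λ L E N a b Y →
                      L :* (E :* (:ι 4 :* (N :* (a :* a :* Y)))) :- E :* (:ι 4 :* (a :* b :* (N :* N :* Y)))
                      := E :* (:ι 4 :* (N :* a :* Y)) :* (L :* a :- N :* b)) refl Λ E N (Λ ⁻¹) (N ⁻¹) ⟪ y , y ⟫) ⟩
          E * (ι 4 * (i * (N * N * ⟪ y , y ⟫)))
            R.≤⟨ *-monoʳ-≤-nonNeg (proj₁ 0<E) (*-monoʳ-≤-nonNeg (ι-nonNeg 4) (*-monoʳ-≤-nonNeg 0≤i N²Y≤)) ⟩
          E * (ι 4 * (i * ((τ * τ) ⁻¹ * (V * V))))
            R.≈⟨ solve 4 (λ E i t W → E :* (:ι 4 :* (i :* (t :* W))) := E :* (:ι 4 :* t) :* i :* W)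
                   refl E i ((τ * τ) ⁻¹) (V * V) ⟩
          L₁ * i * (V * V) R.∎
          where
          ⟪γ,γ⟫≈ : ⟪ γ Q⁻¹ , γ Q⁻¹ ⟫ ≈ Λ ⁻¹ * Λ ⁻¹ * ⟪ y , y ⟫
          ⟪γ,γ⟫≈ = trans (sum-cong (λ j → solve 2 (λ L y → L :* y :* (L :* y) := L :* L :* (y :* y)) refl (Λ ⁻¹) (y j)))
                     (sym (*-distribˡ-sum (Λ ⁻¹ * Λ ⁻¹) (λ j → y j * y j)))
          N²Y≤ : N * N * ⟪ y , y ⟫ ≤ (τ * τ) ⁻¹ * (V * V)
          N²Y≤ = c*x≤y⇒x≤c⁻¹*y 0<τ*τ (≤-respˡ (*-assoc _ _ _) (≤-respʳ (sym (‖‖₂-square deviation))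
            (solution-‖‖₂ 0<τ 0<N coercive {y} {deviation} Qy≈deviation)))

        δ-‖‖∞-absolute : ‖ δ (β Q⁻¹) ‖∞ ≤ M∞ * (Λ ^ ½ * N ^ (½ - σ / ι 2))
        δ-‖‖∞-absolute = R.begin
          ‖ δ (β Q⁻¹) ‖∞                 R.≤⟨ δ-‖‖∞-relative ⟩
          L∞ * i * (D * D)               R.≤⟨ *-monoʳ-≤-nonNeg (*-nonNeg (proj₁ 0<L∞) 0≤i)
                                                (*-mono-≤-nonNeg 0≤D (≤-trans 0≤D deviation-‖‖∞) deviation-‖‖∞ deviation-‖‖∞) ⟩
          L∞ * i * (K∞ * X * (K∞ * X))   R.≈⟨ *-assoc L∞ i _ ⟩
          L∞ * (i * (K∞ * X * (K∞ * X))) R.≈⟨ *-congˡ (x^¾-square K∞ σ) ⟩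
          L∞ * (K∞ * K∞ * _)             R.≈⟨ *-assoc L∞ (K∞ * K∞) _ ⟨
          M∞ * (Λ ^ ½ * N ^ (½ - σ / ι 2)) R.∎
          where
          X = Λ ^ (ι 3 / ι 4) * N ^ (ι 3 / ι 4 - σ / ι 4)
          0≤D = ‖‖∞-nonNeg deviation

        δ-‖‖₁-absolute : ‖ δ (β Q⁻¹) ‖₁ ≤ M₁ * N ^ (1# + ε)
        δ-‖‖₁-absolute = R.begin
          ‖ δ (β Q⁻¹) ‖₁                 R.≤⟨ δ-‖‖₁-relative ⟩
          L₁ * i * (V * V)               R.≤⟨ *-monoʳ-≤-nonNeg (*-nonNeg (proj₁ 0<L₁) 0≤i)
                                                (*-mono-≤-nonNeg 0≤V (≤-trans 0≤V deviation-‖‖₂) deviation-‖‖₂ deviation-‖‖₂) ⟩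
          L₁ * i * (K₂ * X * (K₂ * X))   R.≈⟨ *-assoc L₁ i _ ⟩
          L₁ * (i * (K₂ * X * (K₂ * X))) R.≈⟨ *-congˡ (x^½-square K₂ ε) ⟩
          L₁ * (K₂ * K₂ * _)             R.≈⟨ *-assoc L₁ (K₂ * K₂) _ ⟨
          M₁ * N ^ (1# + ε)              R.∎
          where
          X = Λ ^ ½ * N ^ (1# + ε / ι 2)
          0≤V = ‖‖₂-nonNeg deviation

theorem1p3 : (ℛ : RealNumbers) → let open RealAnalysis ℛ in
    ∀ (σ B τ : ℝ) → 0# < σ → 0# < B → 0# < τ →
    ∃[ ε₀ ] (0# < ε₀ × (∀ (ε : ℝ) → 0# < ε → ε ≤ ε₀ →
    ∀ (K∞ K₂ : ℝ) → 0# < K∞ → 0# < K₂ →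
    ∃[ C ] ∃[ M∞ ] ∃[ M₁ ] ∃[ L∞ ] ∃[ L₁ ] ∃[ N ]
    (0# < C × 0# < M∞ × 0# < M₁ × 0# < L∞ × 0# < L₁ ×
    (∀ (n : ℕ) → N ℕ.≤ n →
    (G : Graph n) (d : Fin n → ℕ) → let open DegreeSequence G d in
    (∀ j → 0 ℕ.< d j) →
    2 ∣ ℕ-Sum.sum d →
    (∀ j → d j ℕ.≤ Graph.degree G j) →
    B * ι n ^ (σ - 1#) ≤ Λ →
    (∃[ h ] (IsCheegerConstant G h × Λ ⁻¹ * (log (ι n) * log (ι n)) ≤ h)) →
    (∃[ q ] (IsLeastEigenvalue (signlessLaplacian G) q × τ * ι n ≤ q)) →
    ‖ deviation ‖∞ ≤ K∞ * (Λ ^ (ι 3 / ι 4) * ι n ^ (ι 3 / ι 4 - σ / ι 4)) →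
    ‖ deviation ‖₂ ≤ K₂ * (Λ ^ ½ * ι n ^ (1# + ε / ι 2)) →
    ∃[ Q⁻¹ ] (IsInverse (signlessLaplacian G) Q⁻¹ ×
    (∀ j k → abs (β Q⁻¹ j - β Q⁻¹ k) ≤ C) ×
    ‖ δ (β Q⁻¹) ‖∞ ≤ M∞ * (Λ ^ ½ * ι n ^ (½ - σ / ι 2)) ×
    ‖ δ (β Q⁻¹) ‖₁ ≤ M₁ * ι n ^ (1# + ε) ×
    ‖ δ (β Q⁻¹) ‖∞ ≤ L∞ * (Λ ⁻¹ * ι n ⁻¹) * (‖ deviation ‖∞ * ‖ deviation ‖∞) ×
    ‖ δ (β Q⁻¹) ‖₁ ≤ L₁ * (Λ ⁻¹ * ι n ⁻¹) * (‖ deviation ‖₂ * ‖ deviation ‖₂))))))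
theorem1p3 ℛ σ B τ 0<σ 0<B 0<τ =
  -- The estimates are uniform in ε, so 1 serves as `ε₀`. The threshold 1 ensures n ≥ 1, which makes
  -- `ι n` invertible and its logarithm nonnegative.
  RealAnalysis.1# ℛ , OrderedField.0<1 ℛ , λ ε _ _ K∞ K₂ 0<K∞ 0<K₂ →
    let open Estimates.Constants ℛ 0<B 0<τ 0<K∞ 0<K₂ in
    C , M∞ , M₁ , L∞ , L₁ , 1 , 0<C , 0<M∞ , 0<M₁ , 0<L∞ , 0<L₁ ,
    λ { (suc m) (s≤s _) G d _ _ _ Bnσ≤Λ _ eigenvalue-bound deviation-‖‖∞ deviation-‖‖₂ →
        let open Conclusions.Bounds ε 0<σ G d Bnσ≤Λ eigenvalue-bound deviation-‖‖∞ deviation-‖‖₂ in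
        Q⁻¹ , Q⁻¹-inverse , β-spread , δ-‖‖∞-absolute , δ-‖‖₁-absolute , δ-‖‖∞-relative , δ-‖‖₁-relative }
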